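{- Let $k\geq 3$ and $1\leq d\leq k-2$. Let $X_{k,d}^1$ be the set consisting of the pattern $321$ together with the patterns $$(d+1,d+2,\dots,k-1,\,1,2,\dots,j,\,k,\,j+1,j+2,\dots,d),\qquad j=0,1,\dots,d,$$ and let $x_{k,d}^1(n)$ be the number of permutations in $S_n$ avoiding every pattern in $X_{k,d}^1$. Then for all $n\geq k$, $$\sum_{j=0}^{k-1}(-1)^j\binom{k-1-j}{j}x_{k,d}^1(n-j)=\binom{n-d-1}{k-d-2},$$ for all $0\leq n\leq k-1$, $x_{k,d}^1(n)=\frac{1}{n+1}\binom{2n}{n}$, and $$\sum_{n\geq0}x_{k,d}^1(n)x^n=\dfrac{U_{k-2}\left(\frac{1}{2\sqrt{x}}\right)+\frac{x^{k/2}}{(1-x)^{k-d-1}}}{\sqrt{x}\,U_{k-1}\left(\frac{1}{2\sqrt{x}}\right)}.$$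
   Context: A permutation $\alpha\in S_n$ contains a pattern $\tau\in S_m$ if there are indices $i_1<\dots<i_m$ with $(\alpha_{i_1},\dots,\alpha_{i_m})$ order-isomorphic to $\tau$; otherwise it avoids $\tau$. $U_m$ is the Chebyshev polynomial of the second kind, $U_m(\cos\theta)=\sin((m+1)\theta)/\sin\theta$. -}

module Defs where

open import Data.Bool using (Bool; true; false; if_then_else_; _∧_; not)
open import Data.Nat as ℕ using (ℕ; zero; suc; _∸_; _<ᵇ_; _≡ᵇ_)
open import Data.Nat.Combinatorics using (_C_)
open import Data.List using (List; []; _∷_; [_]; map; concatMap; upTo; _++_; length; foldr)
open import Data.Bool.ListAction using (any; all)
open import Data.Integer as ℤ using (ℤ; +_; -1ℤ)

insertAll : ℕ → List ℕ → List (List ℕ)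
insertAll x []       = [ x ∷ [] ]
insertAll x (y ∷ ys) = (x ∷ y ∷ ys) ∷ map (y ∷_) (insertAll x ys)

-- perms n enumerates S_n (each permutation exactly once), in one-line
-- notation with values 1..n : insert n into every position of each
-- permutation of S_{n-1}.
perms : ℕ → List (List ℕ)
perms zero    = [ [] ]
perms (suc n) = concatMap (insertAll (suc n)) (perms n)

subseqs : List ℕ → List (List ℕ)
subseqs []       = [ [] ]
subseqs (x ∷ xs) = map (x ∷_) (subseqs xs) ++ subseqs xs

countLess : List ℕ → ℕ → ℕ
countLess []       a = 0
countLess (b ∷ bs) a = if b <ᵇ a then suc (countLess bs a) else countLess bs a

std : List ℕ → List ℕ
std s = map (λ a → suc (countLess s a)) s

eqList : List ℕ → List ℕ → Bool
eqList []       []       = true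
eqList (a ∷ as) (b ∷ bs) = (a ≡ᵇ b) ∧ eqList as bs
eqList _        _        = false

-- α contains τ iff some subsequence of α is order-isomorphic to τ,
-- i.e. its standardisation equals τ
contains : List ℕ → List ℕ → Bool
contains α τ = any (λ s → eqList (std s) τ) (subseqs α)

avoidsAll : List (List ℕ) → List ℕ → Bool
avoidsAll X α = all (λ τ → not (contains α τ)) X

countB : {A : Set} → (A → Bool) → List A → ℕ
countB p []       = 0
countB p (a ∷ as) = if p a then suc (countB p as) else countB p as

interval : ℕ → ℕ → List ℕ
interval a len = map (a ℕ.+_) (upTo len)

pat : ℕ → ℕ → ℕ → List ℕ
pat k d j = interval (suc d) (k ∸ 1 ∸ d) ++ interval 1 j ++ (k ∷ interval (suc j) (d ∸ j))

X¹ : ℕ → ℕ → List (List ℕ)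
X¹ k d = (3 ∷ 2 ∷ 1 ∷ []) ∷ map (pat k d) (upTo (suc d))

x¹ : ℕ → ℕ → ℕ → ℕ
x¹ k d n = countB (avoidsAll (X¹ k d)) (perms n)

Series : Set
Series = ℕ → ℤ

sumℤ : List ℤ → ℤ
sumℤ = foldr ℤ._+_ (+ 0)

_⊛_ : Series → Series → Series
(f ⊛ g) n = sumℤ (map (λ i → f i ℤ.* g (n ∸ i)) (upTo (suc n)))

_⊕_ : Series → Series → Series
(f ⊕ g) n = f n ℤ.+ g n

oneS : Series
oneS zero    = + 1
oneS (suc _) = + 0

xPow : ℕ → Series
xPow m n = if n ≡ᵇ m then + 1 else + 0

shiftX : Series → Series
shiftX f zero    = + 0
shiftX f (suc n) = f n

oneMinusX : Series
oneMinusX zero          = + 1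
oneMinusX (suc zero)    = -1ℤ
oneMinusX (suc (suc _)) = + 0

powS : Series → ℕ → Series
powS f zero    = oneS
powS f (suc r) = f ⊛ powS f r

-- Ŭ m = x^{m/2} U_m(1/(2√x)), a polynomial in x.  From the Chebyshev
-- recurrence U_0 = 1, U_1(y) = 2y, U_{m+2}(y) = 2y U_{m+1}(y) - U_m(y)
-- one gets Ŭ 0 = 1, Ŭ 1 = 1, Ŭ (m+2) = Ŭ (m+1) - x Ŭ m.
Ŭ : ℕ → Series
Ŭ zero          = oneS
Ŭ (suc zero)    = oneS
Ŭ (suc (suc m)) = λ n → Ŭ (suc m) n ℤ.- shiftX (Ŭ m) n

genX : ℕ → ℕ → Series
genX k d n = + x¹ k d n

recLHS : ℕ → ℕ → ℕ → ℤ
recLHS k d n = sumℤ (map (λ j → (-1ℤ ℤ.^ j) ℤ.* (+ ((k ∸ 1 ∸ j) C j)) ℤ.* (+ x¹ k d (n ∸ j))) (upTo k))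

-- Write m = k − 1 − d and let H p q n count the permutations of 1..n that avoid X¹ k d, whose
-- first p letters are increasing and larger than q, and in which 1, …, q occur in increasing
-- order (p, q ≤ n).  For q + 1 ≤ d, either q + 1 also lies beyond the first p letters, or it is
-- the first letter; a first letter ≤ d belongs to no forbidden pattern, so it can be removed and
-- reinserted freely:  H (p+1) q n = H (p+1) (q+1) n + H p q (n−1).  Dually, for p + 1 ≤ m, the
-- letter at index p is either larger than q + 1 or equal to 1, and a 1 at index < m belongs to
-- no forbidden pattern:  H p (q+1) n = H (p+1) (q+1) n + H p q (n−1).  Hence H depends on p + q
-- only, and as series in n it satisfies the Chebyshev recurrence h (r+2) = h (r+1) − x h r with
-- h 0 the generating function sought and h 1 = h 0 − 1, so that Ŭ r · h 0 = h r + Ŭ (r−1).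
-- At the top, p = m and q = d, avoidance forces the maximum n among the first m letters, since
-- otherwise n, the first m letters and 1, …, d form a forbidden pattern.  Such permutations
-- consist of two increasing runs and are counted by C (n−d−1) (m−1), whose series is
-- x^(k−1) / (1 − x)^m.  Since this is x^(k−1) + O(x^k), running the recurrence backwards
-- gives ballot numbers, in particular h 0 n is the n-th Catalan number for n ≤ k − 1.

module Submission where

open import Defs
open import Data.Bool using (Bool; true; false; T; not; if_then_else_)
import Data.Bool.Properties as Bool
open import Data.Empty using (⊥; ⊥-elim)
open import Data.Integer as ℤ using (ℤ; +_; -1ℤ; 0ℤ; 1ℤ)
import Data.Integer.Properties as ℤ
import Data.Integer.Tactic.RingSolver as ℤSolver
open import Data.List using (List; []; _∷_; map; _++_; length; filter; upTo; applyUpTo; take; drop; initLast; _∷ʳ′_)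
open import Data.List.Properties using (length-map; length-++; length-upTo; map-++; map-∘; map-cong; map-upTo;
  map-injective; map-id-local; map-cong-local; take++drop≡id; ++-assoc; filter-++; filter-reject; ∷-injective)
open import Data.List.Membership.Propositional using (_∈_; _∉_; find; lose)
open import Data.List.Membership.Propositional.Properties
open import Data.List.Relation.Binary.Sublist.Propositional
  using (_⊆_; []; _∷_; _∷ʳ_; ⊆-refl; ⊆-trans; minimum; from∈; to∈)
import Data.List.Relation.Binary.Sublist.Propositional.Properties as Sublist
open import Data.List.Relation.Unary.All as All using (All; []; _∷_)
import Data.List.Relation.Unary.All.Properties as All
open import Data.List.Relation.Unary.AllPairs as AllPairs using (AllPairs; []; _∷_)
import Data.List.Relation.Unary.AllPairs.Properties as AllPairs
open import Data.List.Relation.Unary.Any using (here; there)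
import Data.List.Relation.Unary.Any.Properties as Any
open import Data.List.Relation.Unary.Unique.Propositional using (Unique)
import Data.List.Relation.Unary.Unique.Propositional.Properties as Unique
open import Data.Nat
open import Data.Nat.Combinatorics using (_C_; nCk+nC[k+1]≡[n+1]C[k+1]; k>n⇒nCk≡0; nCk≡nC[n∸k]; nCn≡1; nC1≡n)
open import Data.Nat.DivMod using (_/_; m*n/n≡m)
open import Data.Nat.Properties
open import Data.List.Membership.DecPropositional _≟_ using (_∈?_)
import Data.Nat.Tactic.RingSolver as ℕSolver
open import Data.Product using (_×_; _,_; proj₁; proj₂; ∃₂; ∃-syntax)
open import Data.Sum using (_⊎_; inj₁; inj₂)
open import Data.Unit using (tt)
open import Function using (_∘_; case_of_; Equivalence)
open import Function.Definitions using (Injective)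
open import Relation.Binary.Definitions using (tri<; tri≈; tri>)
open import Relation.Binary.PropositionalEquality hiding (J)
open import Relation.Nullary using (¬_; Dec; yes; no; contradiction; map′; _×-dec_; _→-dec_)
open import Relation.Unary using (Decidable)
open ≡-Reasoning

private variable
  A B : Set
  xs ys : List A
  α β s τ us vs : List ℕ
  a b n p q v x y : ℕ
  f f′ g : Series

-- Counting by injections

delete-∈ : ∀ (as : List A) {x bs z} → z ≢ x → z ∈ as ++ x ∷ bs → z ∈ as ++ bs
delete-∈ [] z≢x (here z≡x) = contradiction z≡x z≢x
delete-∈ [] z≢x (there z∈) = z∈
delete-∈ (a ∷ as) z≢x (here z≡a) = here z≡a
delete-∈ (a ∷ as) z≢x (there z∈) = there (delete-∈ as z≢x z∈)

insert-∈ : ∀ (as : List A) {x bs z} → z ∈ as ++ bs → z ∈ as ++ x ∷ bs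
insert-∈ [] z∈ = there z∈
insert-∈ (a ∷ as) (here z≡a) = here z≡a
insert-∈ (a ∷ as) (there z∈) = there (insert-∈ as z∈)

length-insert : ∀ (as : List A) {x bs} → length (as ++ x ∷ bs) ≡ suc (length (as ++ bs))
length-insert [] = refl
length-insert (a ∷ as) = cong suc (length-insert as)

-- Pigeonhole: each head of `xs` is deleted from `ys`, and distinctness keeps the rest of `xs`
-- inside what remains.
length-mono-⊆ : Unique xs → (∀ {z} → z ∈ xs → z ∈ ys) → length xs ≤ length ys
length-mono-⊆ [] _ = z≤n
length-mono-⊆ {xs = x ∷ xs} (x≢ ∷ u) sub with ∈-∃++ (sub (here refl))
... | as , bs , refl = subst (suc (length xs) ≤_) (sym (length-insert as))
  (s≤s (length-mono-⊆ u λ z∈ → delete-∈ as (λ z≡x → All.lookup x≢ z∈ (sym z≡x)) (sub (there z∈))))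

-- If `y` were missing, `y ∷ xs` would be a duplicate-free list inside `ys` and longer than `ys`.
unique⊆-full : ∀ {xs ys : List ℕ} {y} → Unique xs → (∀ {z} → z ∈ xs → z ∈ ys) →
  length ys ≤ length xs → y ∈ ys → y ∈ xs
unique⊆-full {xs} {y = y} u sub len y∈ys with y ∈? xs
... | yes y∈xs = y∈xs
... | no y∉xs = contradiction
  (≤-trans (length-mono-⊆ (All.¬Any⇒All¬ xs y∉xs ∷ u) λ { (here refl) → y∈ys ; (there z∈) → sub z∈ }) len)
  (<-irrefl refl)

count : {P : A → Set} → Decidable P → List A → ℕ
count P? xs = length (filter P? xs)

-- The common form of all the recursions below: a class `P` is a subclass `Q` together with a
-- disjoint injective image of `R`. The hypotheses speak of members of `xs` and `ys` only, because
-- the classes are understood only on permutations. Inclusions between duplicate-free lists both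
-- ways make the order of enumeration irrelevant.
count-split : {P Q : A → Set} {R : B → Set} (P? : Decidable P) (Q? : Decidable Q) (R? : Decidable R)
  (f : B → A) → Injective _≡_ _≡_ f → Unique xs → Unique ys →
  (∀ {x} → x ∈ xs → P x → Q x ⊎ ∃[ y ] y ∈ ys × R y × x ≡ f y) →
  (∀ {x} → x ∈ xs → Q x → P x) →
  (∀ {y} → y ∈ ys → R y → f y ∈ xs × P (f y) × ¬ Q (f y)) →
  count P? xs ≡ count Q? xs + count R? ys
count-split {xs = xs} {ys = ys} P? Q? R? f f-inj uxs uys split Q⇒P R⇒P = begin
  length (filter P? xs)                ≡⟨ ≤-antisym (length-mono-⊆ (Unique.filter⁺ P? uxs) to)
                                                    (length-mono-⊆ unique from) ⟩
  length rhs                           ≡⟨ length-++ (filter Q? xs) ⟩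
  count Q? xs + length (map f (filter R? ys)) ≡⟨ cong (_+_ (count Q? xs)) (length-map f (filter R? ys)) ⟩
  count Q? xs + count R? ys            ∎
  where
  rhs = filter Q? xs ++ map f (filter R? ys)

  to : ∀ {z} → z ∈ filter P? xs → z ∈ rhs
  to z∈ with ∈-filter⁻ P? {xs = xs} z∈
  ... | z∈xs , Pz with split z∈xs Pz
  ... | inj₁ Qz = ∈-++⁺ˡ (∈-filter⁺ Q? z∈xs Qz)
  ... | inj₂ (y , y∈ys , Ry , refl) = ∈-++⁺ʳ (filter Q? xs) (∈-map⁺ f (∈-filter⁺ R? y∈ys Ry))

  from : ∀ {z} → z ∈ rhs → z ∈ filter P? xs
  from z∈ with ∈-++⁻ (filter Q? xs) z∈
  ... | inj₁ z∈Q with z∈xs , Qz ← ∈-filter⁻ Q? {xs = xs} z∈Q = ∈-filter⁺ P? z∈xs (Q⇒P z∈xs Qz)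
  ... | inj₂ z∈R with y , y∈ , refl ← ∈-map⁻ f z∈R
                 with y∈ys , Ry ← ∈-filter⁻ R? {xs = ys} y∈
                 with fy∈ , Pfy , _ ← R⇒P y∈ys Ry = ∈-filter⁺ P? fy∈ Pfy

  unique : Unique rhs
  unique = Unique.++⁺ (Unique.filter⁺ Q? uxs) (Unique.map⁺ f-inj (Unique.filter⁺ R? uys)) disjoint
    where
    disjoint : ∀ {z} → ¬ (z ∈ filter Q? xs × z ∈ map f (filter R? ys))
    disjoint (z∈Q , z∈R) with y , y∈ , refl ← ∈-map⁻ f z∈R
                         with y∈ys , Ry ← ∈-filter⁻ R? {xs = ys} y∈
                         with _ , _ , ¬Qfy ← R⇒P y∈ys Ry = ¬Qfy (proj₂ (∈-filter⁻ Q? {xs = xs} z∈Q))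

count-cong : {P Q : A → Set} (P? : Decidable P) (Q? : Decidable Q) →
  (∀ {x} → x ∈ xs → P x → Q x) → (∀ {x} → x ∈ xs → Q x → P x) → count P? xs ≡ count Q? xs
count-cong {xs = []} P? Q? P⇒Q Q⇒P = refl
count-cong {xs = x ∷ xs} P? Q? P⇒Q Q⇒P with P? x | Q? x
... | yes p | yes q = cong suc (count-cong P? Q? (P⇒Q ∘ there) (Q⇒P ∘ there))
... | no ¬p | no ¬q = count-cong P? Q? (P⇒Q ∘ there) (Q⇒P ∘ there)
... | yes p | no ¬q = contradiction (P⇒Q (here refl) p) ¬q
... | no ¬p | yes q = contradiction (Q⇒P (here refl) q) ¬p

count-none : {P : A → Set} (P? : Decidable P) → (∀ {x} → x ∈ xs → ¬ P x) → count P? xs ≡ 0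
count-none {xs = []} P? ¬P = refl
count-none {xs = x ∷ xs} P? ¬P with P? x
... | yes p = contradiction p (¬P (here refl))
... | no _  = count-none P? (¬P ∘ there)

-- Sublists

-- Together with `pairs⁻`, this turns `AllPairs` into a condition on two-letter sublists, which
-- passes to sublists by `⊆-trans`.
pairs⁺ : {R : A → A → Set} → (∀ {x y} → x ∷ y ∷ [] ⊆ xs → R x y) → AllPairs R xs
pairs⁺ {xs = []} r = []
pairs⁺ {xs = x ∷ xs} r =
  All.tabulate (λ y∈ → r (refl ∷ from∈ y∈)) ∷ pairs⁺ (λ s → r (x ∷ʳ s))

pairs⁻ : ∀ {R : A → A → Set} {x y} → AllPairs R xs → x ∷ y ∷ [] ⊆ xs → R x y
pairs⁻ (_ ∷ rs) (_ ∷ʳ s) = pairs⁻ rs s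
pairs⁻ (r ∷ _) (refl ∷ s) = All.lookup r (to∈ s)

++⊆⁻ : ∀ (us : List A) {vs s} → s ⊆ us ++ vs → ∃₂ λ s₁ s₂ → s ≡ s₁ ++ s₂ × s₁ ⊆ us × s₂ ⊆ vs
++⊆⁻ [] s⊆ = [] , _ , refl , [] , s⊆
++⊆⁻ (u ∷ us) (_ ∷ʳ s⊆) with s₁ , s₂ , eq , p₁ , p₂ ← ++⊆⁻ us s⊆ = s₁ , s₂ , eq , u ∷ʳ p₁ , p₂
++⊆⁻ (u ∷ us) (refl ∷ s⊆) with s₁ , s₂ , refl , p₁ , p₂ ← ++⊆⁻ us s⊆ = u ∷ s₁ , s₂ , refl , refl ∷ p₁ , p₂

⊆map⁻ : (f : A → B) → ∀ {s} → s ⊆ map f xs → ∃[ t ] t ⊆ xs × s ≡ map f t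
⊆map⁻ {xs = []} f [] = [] , [] , refl
⊆map⁻ {xs = x ∷ xs} f (_ ∷ʳ s⊆) with t , t⊆ , refl ← ⊆map⁻ f s⊆ = t , x ∷ʳ t⊆ , refl
⊆map⁻ {xs = x ∷ xs} f (refl ∷ s⊆) with t , t⊆ , refl ← ⊆map⁻ f s⊆ = x ∷ t , refl ∷ t⊆ , refl

⊆-∈ : ∀ {x} → xs ⊆ ys → x ∈ xs → x ∈ ys
⊆-∈ = Sublist.Any-resp-⊆

⊆-unique : xs ⊆ ys → Unique ys → Unique xs
⊆-unique s u = pairs⁺ (λ t → pairs⁻ u (⊆-trans t s))

map≡++⁻ : (f : A → B) → ∀ s {us vs} → map f s ≡ us ++ vs →
  ∃₂ λ s₁ s₂ → s ≡ s₁ ++ s₂ × map f s₁ ≡ us × map f s₂ ≡ vs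
map≡++⁻ f s {[]} eq = [] , s , refl , refl , eq
map≡++⁻ f (a ∷ s) {u ∷ us} eq with ∷-injective eq
... | refl , eq′ with map≡++⁻ f s {us} eq′
... | s₁ , s₂ , refl , refl , eq₂ = a ∷ s₁ , s₂ , refl , refl , eq₂

-- Standardisation and containment

countLess-< : ∀ s → b < a → countLess (b ∷ s) a ≡ suc (countLess s a)
countLess-< {b} {a} s b<a rewrite Equivalence.to Bool.T-≡ (<⇒<ᵇ b<a) = refl

countLess-≮ : ∀ s → a ≤ b → countLess (b ∷ s) a ≡ countLess s a
countLess-≮ {a} {b} s a≤b with b <ᵇ a in eq
... | true  = contradiction (<ᵇ⇒< b a (Equivalence.from Bool.T-≡ eq)) (≤⇒≯ a≤b)
... | false = refl

countLess-++ : ∀ s t a → countLess (s ++ t) a ≡ countLess s a + countLess t a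
countLess-++ [] t a = refl
countLess-++ (b ∷ s) t a with b <ᵇ a
... | true  = cong suc (countLess-++ s t a)
... | false = countLess-++ s t a

countLess-all : All (_< a) s → countLess s a ≡ length s
countLess-all [] = refl
countLess-all {s = b ∷ s} (b<a ∷ rest) = trans (countLess-< s b<a) (cong suc (countLess-all rest))

countLess-none : All (a ≤_) s → countLess s a ≡ 0
countLess-none [] = refl
countLess-none {s = b ∷ s} (a≤b ∷ rest) = trans (countLess-≮ s a≤b) (countLess-none rest)

countLess-mono : ∀ s → a ≤ b → countLess s a ≤ countLess s b
countLess-mono [] a≤b = z≤n
countLess-mono {a} {b} (c ∷ s) a≤b with c <? a
... | yes c<a rewrite countLess-< s c<a | countLess-< s (<-≤-trans c<a a≤b) = s≤s (countLess-mono s a≤b)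
... | no c≮a with c <? b
...   | yes c<b rewrite countLess-≮ s (≮⇒≥ c≮a) | countLess-< s c<b = m≤n⇒m≤1+n (countLess-mono s a≤b)
...   | no c≮b rewrite countLess-≮ s (≮⇒≥ c≮a) | countLess-≮ s (≮⇒≥ c≮b) = countLess-mono s a≤b

-- Contrapositive of `countLess-mono`. It carries an inequality between letters of a pattern over to
-- the letters that play them.
countLess-reflects : ∀ s → countLess s a < countLess s b → a < b
countLess-reflects s lt = ≰⇒> λ b≤a → <⇒≱ lt (countLess-mono s b≤a)

countLess-filter : ∀ s a → countLess s a ≡ length (filter (_<? a) s)
countLess-filter [] a = refl
countLess-filter (b ∷ s) a with b <ᵇ a
... | true  = cong suc (countLess-filter s a)
... | false = countLess-filter s a

length-interval : ∀ b n → length (interval b n) ≡ n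
length-interval b n = trans (length-map (_+_ b) (upTo n)) (length-upTo n)

∈-interval⁺ : ∀ {b n z} → b ≤ z → z < b + n → z ∈ interval b n
∈-interval⁺ {b} {n} {z} b≤z z<b+n = subst (_∈ interval b n) (m+[n∸m]≡n b≤z)
  (∈-map⁺ (_+_ b) (∈-upTo⁺ (+-cancelˡ-< b _ _ (subst (_< b + n) (sym (m+[n∸m]≡n b≤z)) z<b+n))))

∈-interval⁻ : ∀ {b n z} → z ∈ interval b n → b ≤ z × z < b + n
∈-interval⁻ {b} {n} z∈ with i , i∈ , refl ← ∈-map⁻ (_+_ b) z∈ = m≤m+n b i , +-monoʳ-< b (∈-upTo⁻ i∈)

rank : List ℕ → ℕ → ℕ
rank s a = suc (countLess s a)

-- The entries of `s` below `a` are distinct positive integers, so there are at most `a - 1` of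
-- them.
rank≤ : Unique s → All (1 ≤_) s → 1 ≤ a → rank s a ≤ a
rank≤ {s} {suc a} u pos _ = s≤s (subst₂ _≤_ (sym (countLess-filter s (suc a))) (length-interval 1 a)
  (length-mono-⊆ (Unique.filter⁺ (_<? suc a) u) sub))
  where
  sub : ∀ {z} → z ∈ filter (_<? suc a) s → z ∈ interval 1 a
  sub z∈ with z∈s , z< ← ∈-filter⁻ (_<? suc a) {xs = s} z∈ = ∈-interval⁺ (All.lookup pos z∈s) z<

countLess-map : {φ : ℕ → ℕ} → (∀ {x y} → x < y → φ x < φ y) → ∀ s a →
  countLess (map φ s) (φ a) ≡ countLess s a
countLess-map mono [] a = refl
countLess-map {φ} mono (b ∷ s) a with b <? a
... | yes b<a = trans (countLess-< (map φ s) (mono b<a))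
                  (trans (cong suc (countLess-map mono s a)) (sym (countLess-< s b<a)))
... | no b≮a = trans (countLess-≮ (map φ s) (φ-mono-≤ (≮⇒≥ b≮a)))
                  (trans (countLess-map mono s a) (sym (countLess-≮ s (≮⇒≥ b≮a))))
  where
  φ-mono-≤ : ∀ {x y} → x ≤ y → φ x ≤ φ y
  φ-mono-≤ x≤y with m≤n⇒m<n∨m≡n x≤y
  ... | inj₁ x<y = <⇒≤ (mono x<y)
  ... | inj₂ refl = ≤-refl

std-map : {φ : ℕ → ℕ} → (∀ {x y} → x < y → φ x < φ y) → ∀ s → std (map φ s) ≡ std s
std-map {φ} mono s = trans (sym (map-∘ s)) (map-cong (λ a → cong suc (countLess-map mono s a)) s)

std-321 : ∀ {c} → b < a → c < b → std (a ∷ b ∷ c ∷ []) ≡ 3 ∷ 2 ∷ 1 ∷ []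
std-321 {b} {a} {c} b<a c<b
  rewrite countLess-≮ {a} (b ∷ c ∷ []) ≤-refl | countLess-< (c ∷ []) b<a | countLess-< [] (<-trans c<b b<a)
        | countLess-≮ {b} {a} (b ∷ c ∷ []) (<⇒≤ b<a) | countLess-≮ {b} (c ∷ []) ≤-refl | countLess-< [] c<b
        | countLess-≮ {c} {a} (b ∷ c ∷ []) (<⇒≤ (<-trans c<b b<a)) | countLess-≮ {c} {b} (c ∷ []) (<⇒≤ c<b)
        | countLess-≮ {c} [] ≤-refl = refl

Contains : List ℕ → List ℕ → Set
Contains α τ = ∃[ s ] s ⊆ α × std s ≡ τ

Contains-⊆ : α ⊆ β → Contains α τ → Contains β τ
Contains-⊆ α⊆β (s , s⊆α , eq) = s , ⊆-trans s⊆α α⊆β , eq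

Contains-map⁺ : {φ : ℕ → ℕ} → (∀ {x y} → x < y → φ x < φ y) → Contains α τ → Contains (map φ α) τ
Contains-map⁺ {φ = φ} mono (s , s⊆α , eq) = map φ s , Sublist.map⁺ φ s⊆α , trans (std-map mono s) eq

Contains-map⁻ : {φ : ℕ → ℕ} → (∀ {x y} → x < y → φ x < φ y) → Contains (map φ α) τ → Contains α τ
Contains-map⁻ {φ = φ} mono (s , s⊆ , eq) with t , t⊆ , refl ← ⊆map⁻ φ s⊆ = t , t⊆ , trans (sym (std-map mono t)) eq

Contains321⇒ : Contains α (3 ∷ 2 ∷ 1 ∷ []) → ∃[ a ] ∃[ b ] ∃[ c ] a ∷ b ∷ c ∷ [] ⊆ α × b < a × c < b
Contains321⇒ (s@(a ∷ b ∷ c ∷ []) , s⊆ , eq)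
  with eqa , eq₁ ← ∷-injective eq with eqb , eq₂ ← ∷-injective eq₁ with eqc , _ ← ∷-injective eq₂
  = a , b , c , s⊆ , countLess-reflects s (≤-reflexive (trans eqb (sym (suc-injective eqa))))
                   , countLess-reflects s (≤-reflexive (trans eqc (sym (suc-injective eqb))))

⇒Contains321 : ∀ {c} → a ∷ b ∷ c ∷ [] ⊆ α → b < a → c < b → Contains α (3 ∷ 2 ∷ 1 ∷ [])
⇒Contains321 s⊆ b<a c<b = _ , s⊆ , std-321 b<a c<b

∈-subseqs⁺ : s ⊆ α → s ∈ subseqs α
∈-subseqs⁺ [] = here refl
∈-subseqs⁺ {α = a ∷ α} (_ ∷ʳ s⊆) = ∈-++⁺ʳ (map (a ∷_) (subseqs α)) (∈-subseqs⁺ s⊆)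
∈-subseqs⁺ (refl ∷ s⊆) = ∈-++⁺ˡ (∈-map⁺ _ (∈-subseqs⁺ s⊆))

∈-subseqs⁻ : ∀ α → s ∈ subseqs α → s ⊆ α
∈-subseqs⁻ [] (here refl) = []
∈-subseqs⁻ (a ∷ α) s∈ with ∈-++⁻ (map (a ∷_) (subseqs α)) s∈
... | inj₁ s∈₁ with t , t∈ , refl ← ∈-map⁻ (a ∷_) s∈₁ = refl ∷ ∈-subseqs⁻ α t∈
... | inj₂ s∈₂ = a ∷ʳ ∈-subseqs⁻ α s∈₂

eqList⇒≡ : ∀ s t → T (eqList s t) → s ≡ t
eqList⇒≡ [] [] _ = refl
eqList⇒≡ (a ∷ s) (b ∷ t) eq with a≡b , s≡t ← Equivalence.to Bool.T-∧ eq =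
  cong₂ _∷_ (≡ᵇ⇒≡ a b a≡b) (eqList⇒≡ s t s≡t)

eqList-refl : ∀ s → T (eqList s s)
eqList-refl [] = _
eqList-refl (a ∷ s) = Equivalence.from Bool.T-∧ (≡⇒≡ᵇ a a refl , eqList-refl s)

contains⇒ : ∀ α τ → T (contains α τ) → Contains α τ
contains⇒ α τ c with s , s∈ , eq ← find (Any.any⁻ (λ s → eqList (std s) τ) (subseqs α) c)
  = s , ∈-subseqs⁻ α s∈ , eqList⇒≡ (std s) τ eq

⇒contains : ∀ α τ → Contains α τ → T (contains α τ)
⇒contains α τ (s , s⊆ , refl) =
  Any.any⁺ (λ t → eqList (std t) τ) (lose (∈-subseqs⁺ s⊆) (eqList-refl (std s)))

T-not⁻ : ∀ {b} → T (not b) → ¬ T b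
T-not⁻ {false} _ ()

T-not⁺ : ∀ {b} → ¬ T b → T (not b)
T-not⁺ {false} _ = _
T-not⁺ {true} ¬t = ¬t _

avoidsAll⇒ : ∀ X α → T (avoidsAll X α) → ∀ {τ} → τ ∈ X → ¬ Contains α τ
avoidsAll⇒ X α av τ∈ c = T-not⁻ (All.lookup (All.all⁺ _ X av) τ∈) (⇒contains α _ c)

⇒avoidsAll : ∀ X α → (∀ {τ} → τ ∈ X → ¬ Contains α τ) → T (avoidsAll X α)
⇒avoidsAll X α av = All.all⁻ (λ τ → not (contains α τ)) (All.tabulate λ {τ} τ∈ → T-not⁺ (av τ∈ ∘ contains⇒ α τ))

countB≡count : (p : A → Bool) (xs : List A) → countB p xs ≡ count (Bool.T? ∘ p) xs
countB≡count p [] = refl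
countB≡count p (x ∷ xs) with p x
... | true  = cong suc (countB≡count p xs)
... | false = countB≡count p xs

-- Permutations

record IsPerm (n : ℕ) (α : List ℕ) : Set where
  constructor isPerm
  field
    unique : Unique α
    len    : length α ≡ n
    bounds : All (λ v → 1 ≤ v × v ≤ n) α

open IsPerm

-- Surjectivity by counting: `n` distinct letters among `1, …, n` exhaust the interval.
IsPerm-full : IsPerm n α → 1 ≤ v → v ≤ n → v ∈ α
IsPerm-full {n} P 1≤v v≤n = unique⊆-full (unique P)
  (λ z∈ → ∈-interval⁺ (proj₁ (All.lookup (bounds P) z∈)) (s≤s (proj₂ (All.lookup (bounds P) z∈))))
  (≤-reflexive (trans (length-interval 1 n) (sym (len P))))
  (∈-interval⁺ 1≤v (s≤s v≤n))

-- inc q renumbers so as to make room for the value q.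
inc : ℕ → ℕ → ℕ
inc q v = if v <ᵇ q then v else suc v

inc-< : v < q → inc q v ≡ v
inc-< v<q rewrite Equivalence.to Bool.T-≡ (<⇒<ᵇ v<q) = refl

inc-≥ : q ≤ v → inc q v ≡ suc v
inc-≥ {q} {v} q≤v with v <ᵇ q in eq
... | true  = contradiction (<ᵇ⇒< v q (Equivalence.from Bool.T-≡ eq)) (≤⇒≯ q≤v)
... | false = refl

inc≤suc : ∀ q v → inc q v ≤ suc v
inc≤suc q v with v <ᵇ q
... | true  = n≤1+n v
... | false = ≤-refl

≤inc : ∀ q v → v ≤ inc q v
≤inc q v with v <ᵇ q
... | true  = ≤-refl
... | false = n≤1+n v

inc-mono-< : ∀ q {x y} → x < y → inc q x < inc q y
inc-mono-< q {x} {y} x<y with y <? q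
... | yes y<q rewrite inc-< y<q | inc-< (<-trans x<y y<q) = x<y
... | no y≮q rewrite inc-≥ (≮⇒≥ y≮q) = ≤-<-trans (inc≤suc q x) (s≤s x<y)

inc-cancel-< : ∀ q {x y} → inc q x < inc q y → x < y
inc-cancel-< q {x} {y} lt = ≰⇒> λ y≤x → case m≤n⇒m<n∨m≡n y≤x of λ
  { (inj₁ y<x) → <-asym lt (inc-mono-< q y<x) ; (inj₂ refl) → <-irrefl refl lt }

inc-injective : ∀ q → Injective _≡_ _≡_ (inc q)
inc-injective q {x} {y} eq with x <? y | y <? x
... | yes x<y | _ = contradiction eq (<⇒≢ (inc-mono-< q x<y))
... | no _ | yes y<x = contradiction (sym eq) (<⇒≢ (inc-mono-< q y<x))
... | no x≮y | no y≮x = ≤-antisym (≮⇒≥ y≮x) (≮⇒≥ x≮y)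

inc≢ : ∀ q v → inc q v ≢ q
inc≢ q v eq with v <? q
... | yes v<q = <⇒≢ v<q (trans (sym (inc-< v<q)) eq)
... | no v≮q = <⇒≢ (s≤s (≮⇒≥ v≮q)) (sym (trans (sym (inc-≥ (≮⇒≥ v≮q))) eq))

inc-surjective : ∀ q → v ≢ q → ∃[ u ] v ≡ inc q u
inc-surjective {v} q v≢q with v <? q
... | yes v<q = v , sym (inc-< v<q)
... | no v≮q with s≤s {n = u} q≤u ← ≤∧≢⇒< (≮⇒≥ v≮q) (v≢q ∘ sym) = u , sym (inc-≥ q≤u)

map-inc-surjective : ∀ q → q ∉ α → ∃[ β ] α ≡ map (inc q) β
map-inc-surjective {α = []} q _ = [] , refl
map-inc-surjective {α = v ∷ α} q q∉ with u , refl ← inc-surjective q (q∉ ∘ here ∘ sym)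
                                    with β , refl ← map-inc-surjective {α = α} q (q∉ ∘ there) = u ∷ β , refl

∉-map-inc : ∀ q α → q ∉ map (inc q) α
∉-map-inc q α q∈ with u , _ , eq ← ∈-map⁻ (inc q) q∈ = inc≢ q u (sym eq)

∈-insert⁻ : ∀ (as : List A) {x bs z} → z ∈ as ++ x ∷ bs → z ≡ x ⊎ z ∈ as ++ bs
∈-insert⁻ [] (here z≡x) = inj₁ z≡x
∈-insert⁻ [] (there z∈) = inj₂ z∈
∈-insert⁻ (a ∷ as) (here z≡a) = inj₂ (here z≡a)
∈-insert⁻ (a ∷ as) (there z∈) with ∈-insert⁻ as z∈
... | inj₁ z≡x = inj₁ z≡x
... | inj₂ z∈′ = inj₂ (there z∈′)

insert-⊆ : ∀ (as : List A) {x bs} → as ++ bs ⊆ as ++ x ∷ bs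
insert-⊆ [] = _ ∷ʳ ⊆-refl
insert-⊆ (a ∷ as) = refl ∷ insert-⊆ as

Unique-insert⁺ : ∀ (as : List A) {x bs} → x ∉ as ++ bs → Unique (as ++ bs) → Unique (as ++ x ∷ bs)
Unique-insert⁺ [] x∉ u = All.¬Any⇒All¬ _ x∉ ∷ u
Unique-insert⁺ (a ∷ as) x∉ (a∉ ∷ u) =
  All.tabulate (λ z∈ a≡z → case ∈-insert⁻ as z∈ of λ
    { (inj₁ z≡x) → x∉ (here (trans (sym z≡x) (sym a≡z))) ; (inj₂ z∈′) → All.lookup a∉ z∈′ a≡z })
  ∷ Unique-insert⁺ as (x∉ ∘ there) u

Unique-insert⁻ : ∀ (as : List A) {x bs} → Unique (as ++ x ∷ bs) → x ∉ as ++ bs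
Unique-insert⁻ [] (x∉ ∷ u) = All.All¬⇒¬Any x∉
Unique-insert⁻ (a ∷ as) (a∉ ∷ u) (here x≡a) = All.lookup a∉ (∈-++⁺ʳ as (here refl)) (sym x≡a)
Unique-insert⁻ (a ∷ as) (a∉ ∷ u) (there x∈) = Unique-insert⁻ as u x∈

insert-injective : ∀ (as as′ : List A) {x bs bs′} → x ∉ as ++ bs → x ∉ as′ ++ bs′ →
  as ++ x ∷ bs ≡ as′ ++ x ∷ bs′ → as ≡ as′ × bs ≡ bs′
insert-injective [] [] _ _ refl = refl , refl
insert-injective [] (a ∷ as′) _ x∉ refl = contradiction (here refl) x∉
insert-injective (a ∷ as) [] x∉ _ refl = contradiction (here refl) x∉
insert-injective (a ∷ as) (a′ ∷ as′) x∉ x∉′ eq with refl , eq′ ← ∷-injective eq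
  with refl , refl ← insert-injective as as′ (x∉ ∘ there) (x∉′ ∘ there) eq′ = refl , refl

module _ {n q : ℕ} where

  private
    inc≤ : v ≤ n → inc q v ≤ suc n
    inc≤ v≤n = ≤-trans (inc≤suc q _) (s≤s v≤n)

    inc≤⁻ : q ≤ suc n → inc q v ≤ suc n → v ≤ n
    inc≤⁻ {v} q≤ iv≤ with v <? q
    ... | yes v<q = s≤s⁻¹ (≤-trans v<q q≤)
    ... | no v≮q = s≤s⁻¹ (subst (_≤ suc n) (inc-≥ (≮⇒≥ v≮q)) iv≤)

    1≤inc⁻ : 1 ≤ q → 1 ≤ inc q v → 1 ≤ v
    1≤inc⁻ {zero} 1≤q 1≤ = subst (1 ≤_) (inc-< 1≤q) 1≤
    1≤inc⁻ {suc v} _ _ = s≤s z≤n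

  IsPerm-insert⁺ : ∀ as {bs} → 1 ≤ q → q ≤ suc n → IsPerm n (as ++ bs) →
    IsPerm (suc n) (map (inc q) as ++ q ∷ map (inc q) bs)
  IsPerm-insert⁺ as {bs} 1≤q q≤ (isPerm u l b) = isPerm
    (Unique-insert⁺ (map (inc q) as) (subst (q ∉_) (map-++ (inc q) as bs) (∉-map-inc q (as ++ bs)))
      (subst Unique (map-++ (inc q) as bs) (Unique.map⁺ (inc-injective q) u)))
    (trans (length-insert (map (inc q) as)) (cong suc (trans (cong length (sym (map-++ (inc q) as bs)))
      (trans (length-map (inc q) (as ++ bs)) l))))
    (All.tabulate λ z∈ → case ∈-insert⁻ (map (inc q) as) z∈ of λ
      { (inj₁ refl) → 1≤q , q≤
      ; (inj₂ z∈′) → case ∈-map⁻ (inc q) (subst (_ ∈_) (sym (map-++ (inc q) as bs)) z∈′) of λ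
        { (v , v∈ , refl) → let 1≤v , v≤n = All.lookup b v∈ in ≤-trans 1≤v (≤inc q v) , inc≤ v≤n } })

  -- Distinctness keeps `q` out of `as` and `bs`, so all other letters lie in the range of `inc q`
  -- and can be numbered back.
  IsPerm-insert⁻ : ∀ as {bs} → IsPerm (suc n) (as ++ q ∷ bs) →
    ∃₂ λ as′ bs′ → as ≡ map (inc q) as′ × bs ≡ map (inc q) bs′ × IsPerm n (as′ ++ bs′)
  IsPerm-insert⁻ as {bs} (isPerm u l b)
    with as′ , refl ← map-inc-surjective {α = as} q (Unique-insert⁻ as u ∘ ∈-++⁺ˡ)
    with bs′ , refl ← map-inc-surjective {α = bs} q (Unique-insert⁻ as u ∘ ∈-++⁺ʳ as)
    = as′ , bs′ , refl , refl , isPerm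
      (Unique.map⁻ (subst Unique (sym (map-++ (inc q) as′ bs′)) (⊆-unique (insert-⊆ as) u)))
      (suc-injective (trans (cong suc (trans (sym (length-map (inc q) (as′ ++ bs′)))
        (cong length (map-++ (inc q) as′ bs′)))) (trans (sym (length-insert as)) l)))
      (All.tabulate λ {v} v∈ → let 1≤iv , iv≤ = All.lookup b (insert-∈ as (subst (_ ∈_) (map-++ (inc q) as′ bs′) (∈-map⁺ (inc q) v∈))) in
        1≤inc⁻ 1≤q 1≤iv , inc≤⁻ q≤ iv≤)
    where
    1≤q = proj₁ (All.lookup b (∈-++⁺ʳ as (here refl)))
    q≤ = proj₂ (All.lookup b (∈-++⁺ʳ as (here refl)))

-- Makes `insertAll (suc n)`, which renumbers nothing, the case `q = suc n` of `IsPerm-insert⁺` and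
-- `IsPerm-insert⁻`.
map-inc-max : All (_≤ n) α → map (inc (suc n)) α ≡ α
map-inc-max b = map-id-local (All.map (inc-< ∘ s≤s) b)

-- The enumeration of the symmetric group

∈-insertAll⁻ : ∀ {x z} α → z ∈ insertAll x α → ∃₂ λ as bs → α ≡ as ++ bs × z ≡ as ++ x ∷ bs
∈-insertAll⁻ [] (here refl) = [] , [] , refl , refl
∈-insertAll⁻ (y ∷ ys) (here refl) = [] , y ∷ ys , refl , refl
∈-insertAll⁻ (y ∷ ys) (there z∈) with z′ , z′∈ , refl ← ∈-map⁻ (y ∷_) z∈
  with as , bs , refl , refl ← ∈-insertAll⁻ ys z′∈ = y ∷ as , bs , refl , refl

∈-insertAll⁺ : ∀ {x} as bs → as ++ x ∷ bs ∈ insertAll x (as ++ bs)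
∈-insertAll⁺ [] [] = here refl
∈-insertAll⁺ [] (b ∷ bs) = here refl
∈-insertAll⁺ (a ∷ as) bs = there (∈-map⁺ (a ∷_) (∈-insertAll⁺ as bs))

IsPerm⇒∈perms : ∀ n → IsPerm n α → α ∈ perms n
IsPerm⇒∈perms {α = []} zero P = here refl
IsPerm⇒∈perms (suc n) P with as , bs , refl ← ∈-∃++ (IsPerm-full P (s≤s z≤n) ≤-refl)
  with as′ , bs′ , refl , refl , P′ ← IsPerm-insert⁻ as P
  = ∈-concatMap⁺ (insertAll (suc n)) (lose (IsPerm⇒∈perms n P′)
      (subst₂ (λ l r → l ++ suc n ∷ r ∈ insertAll (suc n) (as′ ++ bs′))
        (sym (map-inc-max (All.++⁻ˡ as′ ≤n))) (sym (map-inc-max (All.++⁻ʳ as′ ≤n)))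
        (∈-insertAll⁺ as′ bs′)))
  where
  ≤n : All (_≤ n) (as′ ++ bs′)
  ≤n = All.map proj₂ (bounds P′)

∈perms⇒IsPerm : ∀ n → α ∈ perms n → IsPerm n α
∈perms⇒IsPerm zero (here refl) = isPerm [] refl []
∈perms⇒IsPerm (suc n) α∈ with β , β∈ , α∈′ ← find (∈-concatMap⁻ (insertAll (suc n)) {xs = perms n} α∈)
  with as , bs , refl , refl ← ∈-insertAll⁻ β α∈′
  = subst₂ (λ l r → IsPerm (suc n) (l ++ suc n ∷ r)) (map-inc-max (All.++⁻ˡ as ≤n)) (map-inc-max (All.++⁻ʳ as ≤n))
      (IsPerm-insert⁺ as (s≤s z≤n) ≤-refl P)
  where
  P = ∈perms⇒IsPerm n β∈
  ≤n : All (_≤ n) (as ++ bs)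
  ≤n = All.map proj₂ (bounds P)

insertAll-unique : ∀ {x} α → x ∉ α → Unique (insertAll x α)
insertAll-unique [] _ = [] ∷ []
insertAll-unique {x} (y ∷ ys) x∉ =
  All.tabulate (λ z∈ eq → case ∈-map⁻ (y ∷_) z∈ of λ
    { (_ , _ , refl) → x∉ (here (proj₁ (∷-injective eq))) })
  ∷ Unique.map⁺ (proj₂ ∘ ∷-injective) (insertAll-unique ys (x∉ ∘ there))

-- The maximum marks the place of insertion, so `insert-injective` recovers the shorter permutation;
-- different ones therefore have disjoint lists of insertions.
perms-unique : ∀ n → Unique (perms n)
perms-unique zero = [] ∷ []
perms-unique (suc n) = Unique.concat⁺
  (All.map⁺ (All.tabulate λ α∈ → insertAll-unique _ (max∉ α∈)))
  (AllPairs.map⁺ (pairs⁺ λ {α} {β} s (z∈α , z∈β) →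
    case ∈-insertAll⁻ α z∈α , ∈-insertAll⁻ β z∈β of λ
      { ((as , bs , refl , refl) , (as′ , bs′ , refl , eq)) →
        case insert-injective as as′ (max∉ (⊆-∈ s (here refl))) (max∉ (⊆-∈ s (there (here refl)))) eq of λ
          { (refl , refl) → pairs⁻ (perms-unique n) s refl } }))
  where
  max∉ : α ∈ perms n → suc n ∉ α
  max∉ α∈ max∈ = <-irrefl refl (proj₂ (All.lookup (bounds (∈perms⇒IsPerm n α∈)) max∈))

-- Intervals and increasing words

interval-∷ : ∀ b n → interval b (suc n) ≡ b ∷ interval (suc b) n
interval-∷ b n = cong₂ _∷_ (+-identityʳ b) (begin
  map (_+_ b) (applyUpTo suc n)    ≡⟨ cong (map (_+_ b)) (sym (map-upTo suc n)) ⟩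
  map (_+_ b) (map suc (upTo n))   ≡⟨ sym (map-∘ (upTo n)) ⟩
  map (λ i → b + suc i) (upTo n)  ≡⟨ map-cong (+-suc b) (upTo n) ⟩
  map (_+_ (suc b)) (upTo n)         ∎)

interval-++ : ∀ b i n → interval b (i + n) ≡ interval b i ++ interval (b + i) n
interval-++ b zero n = cong (λ c → interval c n) (sym (+-identityʳ b))
interval-++ b (suc i) n = begin
  interval b (suc (i + n))                         ≡⟨ interval-∷ b (i + n) ⟩
  b ∷ interval (suc b) (i + n)                     ≡⟨ cong (b ∷_) (interval-++ (suc b) i n) ⟩
  b ∷ interval (suc b) i ++ interval (suc b + i) n ≡⟨ cong (_++ interval (suc b + i) n) (sym (interval-∷ b i)) ⟩
  interval b (suc i) ++ interval (suc b + i) n     ≡⟨ cong (λ c → interval b (suc i) ++ interval c n) (sym (+-suc b i)) ⟩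
  interval b (suc i) ++ interval (b + suc i) n     ∎

-- Later finds the index `j` of a forbidden pattern, as the place where a letter cuts the increasing
-- word `1, …, d`.
interval-++⁻ : ∀ b n as {bs} → interval b n ≡ as ++ bs →
  length as ≤ n × as ≡ interval b (length as) × bs ≡ interval (b + length as) (n ∸ length as)
interval-++⁻ b n [] eq = z≤n , refl , trans (sym eq) (cong (λ c → interval c n) (sym (+-identityʳ b)))
interval-++⁻ b (suc n) (a ∷ as) eq
  with refl , eq′ ← ∷-injective (trans (sym (interval-∷ b n)) eq)
  with as≤ , eqa , eqb ← interval-++⁻ (suc b) n as eq′
  = s≤s as≤ , trans (cong (b ∷_) eqa) (sym (interval-∷ b (length as)))
  , trans eqb (cong (λ c → interval c (n ∸ length as)) (sym (+-suc b (length as))))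

interval-increasing : ∀ b n → AllPairs _<_ (interval b n)
interval-increasing b zero = []
interval-increasing b (suc n) = subst (AllPairs _<_) (sym (interval-∷ b n))
  (All.tabulate (λ z∈ → proj₁ (∈-interval⁻ {suc b} {n} z∈)) ∷ interval-increasing (suc b) n)

private
  heads : All (a <_) α → All (b <_) β → a ∈ b ∷ β → b ∈ a ∷ α → a ≡ b
  heads _ _ (here a≡b) _ = a≡b
  heads _ _ (there _) (here b≡a) = sym b≡a
  heads a< b< (there a∈) (there b∈) = contradiction (All.lookup a< b∈) (<-asym (All.lookup b< a∈))

  tails : ∀ {z c γ} → c < z → z ∈ c ∷ γ → z ∈ γ
  tails c<z (here refl) = contradiction c<z (<-irrefl refl)
  tails _ (there z∈) = z∈

-- The head of an increasing word is its minimum, so the heads agree; strictness then removes them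
-- from both tails.
increasing-≡ : AllPairs _<_ α → AllPairs _<_ β →
  (∀ {z} → z ∈ α → z ∈ β) → (∀ {z} → z ∈ β → z ∈ α) → α ≡ β
increasing-≡ {[]} {[]} _ _ _ _ = refl
increasing-≡ {[]} {b ∷ β} _ _ _ from = case from (here refl) of λ ()
increasing-≡ {a ∷ α} {[]} _ _ to _ = case to (here refl) of λ ()
increasing-≡ {a ∷ α} {b ∷ β} (a< ∷ incα) (b< ∷ incβ) to from
  with refl ← heads a< b< (to (here refl)) (from (here refl))
  = cong (a ∷_) (increasing-≡ incα incβ
      (λ z∈ → tails (All.lookup a< z∈) (to (there z∈))) (λ z∈ → tails (All.lookup b< z∈) (from (there z∈))))

-- The head lies below all later letters and adds one to each of their counts; the offset `c`
-- absorbs this in the induction.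
countLess-increasing : AllPairs _<_ α → ∀ c → map (λ a → c + countLess α a) α ≡ interval c (length α)
countLess-increasing [] c = refl
countLess-increasing {a ∷ α} (a< ∷ inc) c = begin
  c + countLess (a ∷ α) a ∷ map (λ z → c + countLess (a ∷ α) z) α
    ≡⟨ cong₂ _∷_ (trans (cong (_+_ c) (countLess-none (≤-refl ∷ All.map <⇒≤ a<))) (+-identityʳ c))
         (map-cong-local (All.map (λ {z} a<z → trans (cong (_+_ c) (countLess-< α a<z)) (+-suc c (countLess α z))) a<)) ⟩
  c ∷ map (λ z → suc c + countLess α z) α  ≡⟨ cong (c ∷_) (countLess-increasing inc (suc c)) ⟩
  c ∷ interval (suc c) (length α)          ≡⟨ sym (interval-∷ c (length α)) ⟩
  interval c (suc (length α))              ∎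

countLess-interval : 1 ≤ v → v ≤ suc n → suc (countLess (interval 1 n) v) ≡ v
countLess-interval {suc v} {n} _ (s≤s v≤n) = cong suc (begin
  countLess (interval 1 n) (suc v)            ≡⟨ cong (λ i → countLess (interval 1 i) (suc v)) (sym (m+[n∸m]≡n v≤n)) ⟩
  countLess (interval 1 (v + (n ∸ v))) (suc v) ≡⟨ cong (λ γ → countLess γ (suc v)) (interval-++ 1 v (n ∸ v)) ⟩
  countLess (interval 1 v ++ interval (suc v) (n ∸ v)) (suc v)
    ≡⟨ countLess-++ (interval 1 v) (interval (suc v) (n ∸ v)) (suc v) ⟩
  countLess (interval 1 v) (suc v) + countLess (interval (suc v) (n ∸ v)) (suc v)
    ≡⟨ cong₂ _+_ (countLess-all (All.tabulate λ z∈ → proj₂ (∈-interval⁻ {1} {v} z∈)))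
                 (countLess-none (All.tabulate λ z∈ → proj₁ (∈-interval⁻ {suc v} {n ∸ v} z∈))) ⟩
  length (interval 1 v) + 0                   ≡⟨ +-identityʳ _ ⟩
  length (interval 1 v)                       ≡⟨ length-interval 1 v ⟩
  v                                           ∎)

⊆-insert⁻ : ∀ (as : List A) {x bs s} → s ⊆ as ++ x ∷ bs →
  s ⊆ as ++ bs ⊎ ∃₂ λ s₁ s₂ → s ≡ s₁ ++ x ∷ s₂ × s₁ ⊆ as × s₂ ⊆ bs
⊆-insert⁻ as s⊆ with s₁ , s₂ , refl , p₁ , p₂ ← ++⊆⁻ as s⊆ with p₂
... | _ ∷ʳ p = inj₁ (Sublist.++⁺ p₁ p)
... | refl ∷ p = inj₂ (s₁ , _ , refl , p₁ , p)

++-∈-prefix : ∀ (xs ps : List A) {y ys rs} → xs ++ y ∷ ys ≡ ps ++ rs → length xs < length ps → y ∈ ps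
++-∈-prefix [] (p ∷ ps) eq _ = here (proj₁ (∷-injective eq))
++-∈-prefix (x ∷ xs) (p ∷ ps) eq (s≤s lt) = there (++-∈-prefix xs ps (proj₂ (∷-injective eq)) lt)

Unique-++⁻ : ∀ {us vs : List A} {z} → Unique (us ++ vs) → z ∈ us → ¬ z ∈ vs
Unique-++⁻ u z∈us z∈vs = pairs⁻ u (Sublist.++⁺ (from∈ z∈us) (from∈ z∈vs)) refl

-- Words cut after their first p letters

Split : ℕ → (List ℕ → List ℕ → Set) → List ℕ → Set
Split p P α = ∃₂ λ us vs → α ≡ us ++ vs × length us ≡ p × P us vs

-- The length of `us` fixes the cut, so only one decomposition has to be tested.
split? : {P : List ℕ → List ℕ → Set} → ∀ p → (∀ us vs → Dec (P us vs)) → ∀ α → Dec (Split p P α)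
split? zero P? α = map′ (λ x → [] , α , refl , refl , x) (λ { ([] , _ , refl , _ , x) → x }) (P? [] α)
split? (suc p) P? [] = no λ { ([] , _ , _ , () , _) ; (_ ∷ _ , _ , () , _) }
split? (suc p) P? (a ∷ α) = map′
  (λ { (us , vs , refl , l , x) → a ∷ us , vs , refl , cong suc l , x })
  (λ { ([] , _ , _ , () , _) ; (_ ∷ us , vs , refl , l , x) → us , vs , refl , suc-injective l , x })
  (split? p (λ us vs → P? (a ∷ us) vs) α)

-- Under `AllPairs`, this says that the values up to `q` occur in increasing order and leaves larger
-- values free.
Ord : ℕ → ℕ → ℕ → Set
Ord q x y = x ≤ q → y ≤ q → x < y

Shape : ℕ → List ℕ → List ℕ → Set
Shape q us vs = AllPairs _<_ us × All (q <_) us × AllPairs (Ord q) vs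

shape? : ∀ q us vs → Dec (Shape q us vs)
shape? q us vs = AllPairs.allPairs? _<?_ us ×-dec All.all? (q <?_) us ×-dec
  AllPairs.allPairs? (λ x y → x ≤? q →-dec (y ≤? q →-dec x <? y)) vs

inc1-≤ : inc 1 x ≤ suc q → x ≤ q
inc1-≤ {zero} _ = z≤n
inc1-≤ {suc x} (s≤s x≤q) = x≤q

inc1-positive : ∀ α → All (1 ≤_) α → All (1 <_) (map (inc 1) α)
inc1-positive α pos = All.map⁺ (All.map (λ 1≤v → subst (1 <_) (sym (inc-≥ 1≤v)) (s≤s 1≤v)) pos)

inc-increasing : ∀ q → AllPairs _<_ α → AllPairs _<_ (map (inc q) α)
inc-increasing q up = AllPairs.map⁺ (AllPairs.map (inc-mono-< q) up)

inc-increasing⁻ : ∀ q → AllPairs _<_ (map (inc q) α) → AllPairs _<_ α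
inc-increasing⁻ q up = AllPairs.map (inc-cancel-< q) (AllPairs.map⁻ up)

positive : IsPerm n α → All (1 ≤_) α
positive P = All.map proj₁ (bounds P)

≤n : IsPerm n α → v ∈ α → v ≤ n
≤n P v∈ = proj₂ (All.lookup (bounds P) v∈)

1≤ : IsPerm n α → v ∈ α → 1 ≤ v
1≤ P v∈ = proj₁ (All.lookup (bounds P) v∈)

IsPerm-cons⁺ : 1 ≤ q → q ≤ suc n → β ∈ perms n → q ∷ map (inc q) β ∈ perms (suc n)
IsPerm-cons⁺ {n = n} 1≤q q≤ β∈ = IsPerm⇒∈perms (suc n) (IsPerm-insert⁺ [] 1≤q q≤ (∈perms⇒IsPerm n β∈))

cons-inc-injective : ∀ q → Injective _≡_ _≡_ (λ β → q ∷ map (inc q) β)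
cons-inc-injective q eq = map-injective (inc-injective q) (proj₂ (∷-injective eq))

-- Given by `take` and `drop` and not on a decomposition, since `count-split` asks for a map that is
-- injective on all lists.
insert1 : ℕ → List ℕ → List ℕ
insert1 p β = map (inc 1) (take p β) ++ 1 ∷ map (inc 1) (drop p β)

insert1-++ : ∀ us vs → insert1 (length us) (us ++ vs) ≡ map (inc 1) us ++ 1 ∷ map (inc 1) vs
insert1-++ [] vs = refl
insert1-++ (u ∷ us) vs = cong (inc 1 u ∷_) (insert1-++ us vs)

∉-map-inc-++ : ∀ q us vs → q ∉ map (inc q) us ++ map (inc q) vs
∉-map-inc-++ q us vs = subst (q ∉_) (map-++ (inc q) us vs) (∉-map-inc q (us ++ vs))

insert1-injective : ∀ p → Injective _≡_ _≡_ (insert1 p)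
insert1-injective p {β} {γ} eq
  with eq₁ , eq₂ ← insert-injective (map (inc 1) (take p β)) (map (inc 1) (take p γ)) (∉-map-inc-++ 1 _ (drop p β)) (∉-map-inc-++ 1 _ (drop p γ)) eq
  = trans (sym (take++drop≡id p β)) (trans (cong₂ _++_
      (map-injective (inc-injective 1) eq₁) (map-injective (inc-injective 1) eq₂)) (take++drop≡id p γ))

-- Permutations with two increasing runs

TwoRuns : ℕ → ℕ → List ℕ → List ℕ → Set
TwoRuns n q us vs = AllPairs _<_ us × All (q <_) us × AllPairs _<_ vs × n ∈ us

twoRuns? : ∀ n q us vs → Dec (TwoRuns n q us vs)
twoRuns? n q us vs = AllPairs.allPairs? _<?_ us ×-dec All.all? (q <?_) us ×-dec
  AllPairs.allPairs? _<?_ vs ×-dec n ∈? us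

twoRunsCount : ℕ → ℕ → ℕ → ℕ
twoRunsCount p q n = count (split? p (twoRuns? n q)) (perms n)

sorted? : ∀ α → Dec (AllPairs _<_ α)
sorted? = AllPairs.allPairs? _<?_

-- The case of `count-split` in which `Q` is empty.
count-bij : ∀ {A B : Set} {P : A → Set} {R : B → Set} {xs ys} (P? : Decidable P) (R? : Decidable R)
  (f : B → A) → Injective _≡_ _≡_ f → Unique xs → Unique ys →
  (∀ {x} → x ∈ xs → P x → ∃[ y ] y ∈ ys × R y × x ≡ f y) →
  (∀ {y} → y ∈ ys → R y → f y ∈ xs × P (f y)) →
  count P? xs ≡ count R? ys
count-bij {A = A} {xs = xs} P? R? f f-inj uxs uys P⇒R R⇒P = trans
  (count-split P? never? R? f f-inj uxs uys (λ x∈ → inj₂ ∘ P⇒R x∈) (λ _ ()) λ y∈ r →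
    proj₁ (R⇒P y∈ r) , proj₂ (R⇒P y∈ r) , λ ())
  (cong (_+ _) (count-none {xs = xs} never? λ _ ()))
  where
  never? : Decidable {A = A} (λ _ → ⊥)
  never? _ = no λ ()

sorted-count : ∀ n → count sorted? (perms n) ≡ 1
sorted-count zero = refl
sorted-count (suc n) = trans
  (count-bij sorted? sorted? (λ β → 1 ∷ map (inc 1) β) (cons-inc-injective 1) (perms-unique (suc n)) (perms-unique n)
    remove λ β∈ up → IsPerm-cons⁺ {n = n} ≤-refl (s≤s z≤n) β∈ ,
      inc1-positive _ (positive (∈perms⇒IsPerm n β∈)) ∷ inc-increasing 1 up)
  (sorted-count n)
  where
  remove : α ∈ perms (suc n) → AllPairs _<_ α → ∃[ β ] β ∈ perms n × AllPairs _<_ β × α ≡ 1 ∷ map (inc 1) β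
  remove α∈ [] = case len (∈perms⇒IsPerm (suc n) α∈) of λ ()
  remove α∈ (a< ∷ up) with IsPerm-full (∈perms⇒IsPerm (suc n) α∈) ≤-refl (s≤s z≤n)
  ... | there 1∈ = contradiction (All.lookup a< 1∈) (≤⇒≯ (1≤ (∈perms⇒IsPerm (suc n) α∈) (here refl)))
  ... | here refl with [] , β , refl , refl , P ← IsPerm-insert⁻ [] (∈perms⇒IsPerm (suc n) α∈) =
    β , IsPerm⇒∈perms n P , inc-increasing⁻ 1 up , refl

-- The first run is the maximum alone, and the remaining word is sorted.
twoRuns-one : ∀ q n → q ≤ n → twoRunsCount 1 q (suc n) ≡ 1
twoRuns-one q n q≤n = trans
  (count-bij (split? 1 (twoRuns? (suc n) q)) sorted? (λ β → suc n ∷ map (inc (suc n)) β)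
    (cons-inc-injective (suc n)) (perms-unique (suc n)) (perms-unique n) remove λ β∈ up →
      IsPerm-cons⁺ (s≤s z≤n) ≤-refl β∈
      , _ ∷ [] , _ , refl , refl , [] ∷ [] , s≤s q≤n ∷ [] , inc-increasing (suc n) up , here refl)
  (sorted-count n)
  where
  remove : α ∈ perms (suc n) → Split 1 (TwoRuns (suc n) q) α →
    ∃[ β ] β ∈ perms n × AllPairs _<_ β × α ≡ suc n ∷ map (inc (suc n)) β
  remove α∈ (_ ∷ [] , vs , refl , _ , _ , _ , up , here refl)
    with [] , β , refl , refl , P ← IsPerm-insert⁻ [] (∈perms⇒IsPerm (suc n) α∈) =
    β , IsPerm⇒∈perms n P , inc-increasing⁻ (suc n) up , refl

twoRuns-none : n ≤ q → twoRunsCount p q n ≡ 0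
twoRuns-none {n} {q} {p} n≤q = count-none {xs = perms n} (split? p (twoRuns? n q))
  λ { _ (_ , _ , _ , _ , _ , big , _ , n∈) → contradiction (All.lookup big n∈) (≤⇒≯ n≤q) }

-- Either the first letter exceeds `suc q`, or it is `suc q` and gets removed. The first run has at
-- least two letters here, so the letter removed is not the maximum.
twoRuns-step : ∀ p q n →
  twoRunsCount (suc (suc p)) q (suc n) ≡ twoRunsCount (suc (suc p)) (suc q) (suc n) + twoRunsCount (suc p) q n
twoRuns-step p q n = count-split
  (split? (suc (suc p)) (twoRuns? (suc n) q)) (split? (suc (suc p)) (twoRuns? (suc n) (suc q))) (split? (suc p) (twoRuns? n q))
  (λ β → suc q ∷ map (inc (suc q)) β) (cons-inc-injective (suc q)) (perms-unique (suc n)) (perms-unique n)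
  splits weaken inserts
  where
  splits : α ∈ perms (suc n) → Split (suc (suc p)) (TwoRuns (suc n) q) α →
    Split (suc (suc p)) (TwoRuns (suc n) (suc q)) α ⊎
    ∃[ β ] β ∈ perms n × Split (suc p) (TwoRuns n q) β × α ≡ suc q ∷ map (inc (suc q)) β
  splits α∈ (a ∷ us , vs , refl , l , a< ∷ up , q<a ∷ big , upv , n∈) with a ≟ suc q
  ... | no a≢ = inj₁ (a ∷ us , vs , refl , l , a< ∷ up , q+1<a ∷ All.map (<-trans q+1<a) a< , upv , n∈)
    where
    q+1<a = ≤∧≢⇒< q<a (a≢ ∘ sym)
  splits α∈ (_ ∷ u ∷ us , vs , refl , l , (a<u ∷ _) ∷ up , q<a ∷ big , upv , here refl) | yes refl =
    contradiction (≤n (∈perms⇒IsPerm (suc n) α∈) (there (here refl))) (<⇒≱ a<u)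
  splits α∈ (_ ∷ us , vs , refl , l , a< ∷ up , q<a ∷ big , upv , there n∈) | yes refl
    with [] , β , refl , eq , P ← IsPerm-insert⁻ [] (∈perms⇒IsPerm (suc n) α∈)
    with us′ , vs′ , refl , refl , refl ← map≡++⁻ (inc (suc q)) β {us} {vs} (sym eq)
    with u , u∈ , n≡ ← ∈-map⁻ (inc (suc q)) n∈
    = inj₂ (us′ ++ vs′ , IsPerm⇒∈perms n P
      , (us′ , vs′ , refl , trans (sym (length-map (inc (suc q)) us′)) (suc-injective l)
        , inc-increasing⁻ (suc q) up , big′ , inc-increasing⁻ (suc q) upv
        , subst (_∈ us′) (suc-injective (sym (trans n≡ (inc-≥ (All.lookup big′ u∈))))) u∈)
      , cong (suc q ∷_) eq)
    where
    big′ : All (q <_) us′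
    big′ = All.map (λ {u} lt → s≤s⁻¹ (≤-trans lt (inc≤suc (suc q) u))) (All.map⁻ a<)

  weaken : α ∈ perms (suc n) → Split (suc (suc p)) (TwoRuns (suc n) (suc q)) α → Split (suc (suc p)) (TwoRuns (suc n) q) α
  weaken _ (us , vs , eq , l , up , big , rest) = us , vs , eq , l , up , All.map <⇒≤ big , rest

  inserts : β ∈ perms n → Split (suc p) (TwoRuns n q) β → suc q ∷ map (inc (suc q)) β ∈ perms (suc n) ×
    Split (suc (suc p)) (TwoRuns (suc n) q) (suc q ∷ map (inc (suc q)) β) ×
    ¬ Split (suc (suc p)) (TwoRuns (suc n) (suc q)) (suc q ∷ map (inc (suc q)) β)
  inserts β∈ (us , vs , refl , l , up , big , upv , n∈) =
    IsPerm-cons⁺ (s≤s z≤n) (m≤n⇒m≤1+n q<n) β∈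
    , ( suc q ∷ map (inc (suc q)) us , map (inc (suc q)) vs
      , cong (suc q ∷_) (map-++ (inc (suc q)) us vs) , cong suc (trans (length-map _ us) l)
      , All.map⁺ (All.map (λ q<u → subst (suc q <_) (sym (inc-≥ q<u)) (s≤s q<u)) big) ∷ inc-increasing (suc q) up
      , ≤-refl ∷ All.map⁺ (All.map (λ {u} q<u → ≤-trans q<u (≤inc (suc q) u)) big)
      , inc-increasing (suc q) upv
      , there (subst (_∈ map (inc (suc q)) us) (inc-≥ q<n) (∈-map⁺ (inc (suc q)) n∈)))
    , λ { (_ ∷ _ , _ , eq , _ , _ , lt ∷ _ , _) → <-irrefl (proj₁ (∷-injective eq)) lt }
    where
    q<n : q < n
    q<n = All.lookup big n∈

-- There are `i` values strictly between `q` and the maximum; choosing `p` of them for the first run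
-- determines the permutation. `twoRuns-step` turns this into Pascal's rule.
twoRuns-count : ∀ p q i → twoRunsCount (suc p) q (suc (q + i)) ≡ i C p
twoRuns-count zero q i = twoRuns-one q (q + i) (m≤m+n q i)
twoRuns-count (suc p) q zero = trans (twoRuns-step p q (q + 0))
  (cong₂ _+_ (twoRuns-none {p = suc (suc p)} (s≤s q+0≤q)) (twoRuns-none {p = suc p} q+0≤q))
  where
  q+0≤q = ≤-reflexive (+-identityʳ q)
twoRuns-count (suc p) q (suc i) = begin
  twoRunsCount (suc (suc p)) q (suc (q + suc i))
    ≡⟨ twoRuns-step p q (q + suc i) ⟩
  twoRunsCount (suc (suc p)) (suc q) (suc (q + suc i)) + twoRunsCount (suc p) q (q + suc i)
    ≡⟨ cong (λ r → twoRunsCount (suc (suc p)) (suc q) (suc r) + twoRunsCount (suc p) q r) (+-suc q i) ⟩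
  twoRunsCount (suc (suc p)) (suc q) (suc (suc q + i)) + twoRunsCount (suc p) q (suc (q + i))
    ≡⟨ cong₂ _+_ (twoRuns-count (suc p) (suc q) i) (twoRuns-count p q i) ⟩
  i C suc p + i C p  ≡⟨ +-comm (i C suc p) (i C p) ⟩
  i C p + i C suc p  ≡⟨ nCk+nC[k+1]≡[n+1]C[k+1] i p ⟩
  suc i C suc p      ∎

-- Each run increases, so a descent has to cross from the first run into the second. The last four
-- clauses rule out splittings of the wrong length.
descent : ∀ us → AllPairs _<_ us → AllPairs _<_ vs → x ∷ y ∷ [] ⊆ us ++ vs → y < x → x ∈ us × y ∈ vs
descent us up upv s y<x with ++⊆⁻ us s
... | [] , _ , refl , _ , s₂ = contradiction y<x (<-asym (pairs⁻ upv s₂))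
... | _ ∷ [] , _ ∷ [] , refl , s₁ , s₂ = to∈ s₁ , to∈ s₂
... | _ ∷ _ ∷ [] , [] , refl , s₁ , _ = contradiction y<x (<-asym (pairs⁻ up s₁))
... | _ ∷ [] , [] , () , _ , _
... | _ ∷ [] , _ ∷ _ ∷ _ , () , _ , _
... | _ ∷ _ ∷ [] , _ ∷ _ , () , _ , _
... | _ ∷ _ ∷ _ ∷ _ , _ , () , _ , _

-- Power series

map-applyUpTo-suc : (F : ℕ → ℤ) → ∀ N → map F (applyUpTo suc N) ≡ map (F ∘ suc) (upTo N)
map-applyUpTo-suc F N = trans (cong (map F) (sym (map-upTo suc N))) (sym (map-∘ (upTo N)))

sum-upTo-suc : (F : ℕ → ℤ) → ∀ N → sumℤ (map F (upTo (suc N))) ≡ F 0 ℤ.+ sumℤ (map (F ∘ suc) (upTo N))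
sum-upTo-suc F N = cong (λ t → F 0 ℤ.+ sumℤ t) (map-applyUpTo-suc F N)

sum-upTo-zero : (F : ℕ → ℤ) → (∀ i → F i ≡ 0ℤ) → ∀ N → sumℤ (map F (upTo N)) ≡ 0ℤ
sum-upTo-zero F F≡0 zero = refl
sum-upTo-zero F F≡0 (suc N) =
  trans (sum-upTo-suc F N) (cong₂ ℤ._+_ (F≡0 0) (sum-upTo-zero (F ∘ suc) (F≡0 ∘ suc) N))

sum-upTo-truncate : (F : ℕ → ℤ) → ∀ a b → (∀ i → a ≤ i → F i ≡ 0ℤ) →
  sumℤ (map F (upTo (a + b))) ≡ sumℤ (map F (upTo a))
sum-upTo-truncate F zero b F≡0 = sum-upTo-zero F (λ i → F≡0 i z≤n) b
sum-upTo-truncate F (suc a) b F≡0 = trans (sum-upTo-suc F (a + b))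
  (trans (cong (λ t → F 0 ℤ.+ t) (sum-upTo-truncate (F ∘ suc) a b (λ i a≤i → F≡0 (suc i) (s≤s a≤i)))) (sym (sum-upTo-suc F a)))

⊛-zero : ∀ f g → (f ⊛ g) 0 ≡ f 0 ℤ.* g 0
⊛-zero f g = ℤ.+-identityʳ _

⊛-suc : ∀ f g n → (f ⊛ g) (suc n) ≡ f 0 ℤ.* g (suc n) ℤ.+ ((f ∘ suc) ⊛ g) n
⊛-suc f g n = sum-upTo-suc (λ i → f i ℤ.* g (suc n ∸ i)) (suc n)

-- The mirror image of `⊛-suc`: it peels off the last summand instead of the first, and `⊛-comm`
-- plays one against the other.
⊛-sucʳ : ∀ f g n → (f ⊛ g) (suc n) ≡ (f ⊛ (g ∘ suc)) n ℤ.+ f (suc n) ℤ.* g 0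
⊛-sucʳ f g zero = begin
  (f ⊛ g) 1                              ≡⟨ ⊛-suc f g 0 ⟩
  f 0 ℤ.* g 1 ℤ.+ ((f ∘ suc) ⊛ g) 0          ≡⟨ cong (λ t → f 0 ℤ.* g 1 ℤ.+ t) (⊛-zero (f ∘ suc) g) ⟩
  f 0 ℤ.* g 1 ℤ.+ f 1 ℤ.* g 0                  ≡⟨ cong (ℤ._+ f 1 ℤ.* g 0) (sym (⊛-zero f (g ∘ suc))) ⟩
  (f ⊛ (g ∘ suc)) 0 ℤ.+ f 1 ℤ.* g 0          ∎
⊛-sucʳ f g (suc n) = begin
  (f ⊛ g) (suc (suc n))
    ≡⟨ ⊛-suc f g (suc n) ⟩
  f 0 ℤ.* g (suc (suc n)) ℤ.+ ((f ∘ suc) ⊛ g) (suc n)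
    ≡⟨ cong (λ t → f 0 ℤ.* g (suc (suc n)) ℤ.+ t) (⊛-sucʳ (f ∘ suc) g n) ⟩
  f 0 ℤ.* g (suc (suc n)) ℤ.+ (((f ∘ suc) ⊛ (g ∘ suc)) n ℤ.+ f (suc (suc n)) ℤ.* g 0)
    ≡⟨ sym (ℤ.+-assoc (f 0 ℤ.* g (suc (suc n))) _ _) ⟩
  f 0 ℤ.* g (suc (suc n)) ℤ.+ ((f ∘ suc) ⊛ (g ∘ suc)) n ℤ.+ f (suc (suc n)) ℤ.* g 0
    ≡⟨ cong (ℤ._+ f (suc (suc n)) ℤ.* g 0) (sym (⊛-suc f (g ∘ suc) n)) ⟩
  (f ⊛ (g ∘ suc)) (suc n) ℤ.+ f (suc (suc n)) ℤ.* g 0 ∎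

⊛-congˡ : ∀ g → (∀ n → f n ≡ f′ n) → ∀ n → (f ⊛ g) n ≡ (f′ ⊛ g) n
⊛-congˡ g f≡ n = cong sumℤ (map-cong (λ i → cong (ℤ._* g (n ∸ i)) (f≡ i)) (upTo (suc n)))

⊛-comm : ∀ f g n → (f ⊛ g) n ≡ (g ⊛ f) n
⊛-comm f g zero = trans (⊛-zero f g) (trans (ℤ.*-comm (f 0) (g 0)) (sym (⊛-zero g f)))
⊛-comm f g (suc n) = begin
  (f ⊛ g) (suc n)                          ≡⟨ ⊛-suc f g n ⟩
  f 0 ℤ.* g (suc n) ℤ.+ ((f ∘ suc) ⊛ g) n      ≡⟨ cong₂ ℤ._+_ (ℤ.*-comm (f 0) (g (suc n))) (⊛-comm (f ∘ suc) g n) ⟩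
  g (suc n) ℤ.* f 0 ℤ.+ (g ⊛ (f ∘ suc)) n      ≡⟨ ℤ.+-comm (g (suc n) ℤ.* f 0) _ ⟩
  (g ⊛ (f ∘ suc)) n ℤ.+ g (suc n) ℤ.* f 0      ≡⟨ sym (⊛-sucʳ g f n) ⟩
  (g ⊛ f) (suc n)                          ∎

-- The combination is the one that `⊛-suc` produces for an inner product, as met in `⊛-assoc`; the
-- scalars 1 and -1 give sums and differences.
⊛-linearˡ : ∀ c f g h n → ((λ i → c ℤ.* f i ℤ.+ g i) ⊛ h) n ≡ c ℤ.* (f ⊛ h) n ℤ.+ (g ⊛ h) n
⊛-linearˡ c f g h zero = begin
  ((λ i → c ℤ.* f i ℤ.+ g i) ⊛ h) 0            ≡⟨ ⊛-zero (λ i → c ℤ.* f i ℤ.+ g i) h ⟩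
  (c ℤ.* f 0 ℤ.+ g 0) ℤ.* h 0                    ≡⟨ expand c (f 0) (g 0) (h 0) ⟩
  c ℤ.* (f 0 ℤ.* h 0) ℤ.+ g 0 ℤ.* h 0              ≡⟨ sym (cong₂ (λ s t → c ℤ.* s ℤ.+ t) (⊛-zero f h) (⊛-zero g h)) ⟩
  c ℤ.* (f ⊛ h) 0 ℤ.+ (g ⊛ h) 0                ∎
  where
  expand : ∀ c x y z → (c ℤ.* x ℤ.+ y) ℤ.* z ≡ c ℤ.* (x ℤ.* z) ℤ.+ y ℤ.* z
  expand = ℤSolver.solve-∀
⊛-linearˡ c f g h (suc n) = begin
  ((λ i → c ℤ.* f i ℤ.+ g i) ⊛ h) (suc n)
    ≡⟨ ⊛-suc (λ i → c ℤ.* f i ℤ.+ g i) h n ⟩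
  (c ℤ.* f 0 ℤ.+ g 0) ℤ.* h (suc n) ℤ.+ ((λ i → c ℤ.* f (suc i) ℤ.+ g (suc i)) ⊛ h) n
    ≡⟨ cong (λ t → (c ℤ.* f 0 ℤ.+ g 0) ℤ.* h (suc n) ℤ.+ t) (⊛-linearˡ c (f ∘ suc) (g ∘ suc) h n) ⟩
  (c ℤ.* f 0 ℤ.+ g 0) ℤ.* h (suc n) ℤ.+ (c ℤ.* ((f ∘ suc) ⊛ h) n ℤ.+ ((g ∘ suc) ⊛ h) n)
    ≡⟨ rearrange c (f 0) (g 0) (h (suc n)) _ _ ⟩
  c ℤ.* (f 0 ℤ.* h (suc n) ℤ.+ ((f ∘ suc) ⊛ h) n) ℤ.+ (g 0 ℤ.* h (suc n) ℤ.+ ((g ∘ suc) ⊛ h) n)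
    ≡⟨ sym (cong₂ (λ s t → c ℤ.* s ℤ.+ t) (⊛-suc f h n) (⊛-suc g h n)) ⟩
  c ℤ.* (f ⊛ h) (suc n) ℤ.+ (g ⊛ h) (suc n) ∎
  where
  rearrange : ∀ c x y z s t → (c ℤ.* x ℤ.+ y) ℤ.* z ℤ.+ (c ℤ.* s ℤ.+ t) ≡ c ℤ.* (x ℤ.* z ℤ.+ s) ℤ.+ (y ℤ.* z ℤ.+ t)
  rearrange = ℤSolver.solve-∀

⊛-assoc : ∀ f g h n → ((f ⊛ g) ⊛ h) n ≡ (f ⊛ (g ⊛ h)) n
⊛-assoc f g h zero = begin
  ((f ⊛ g) ⊛ h) 0    ≡⟨ trans (⊛-zero (f ⊛ g) h) (cong (ℤ._* h 0) (⊛-zero f g)) ⟩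
  f 0 ℤ.* g 0 ℤ.* h 0    ≡⟨ ℤ.*-assoc (f 0) (g 0) (h 0) ⟩
  f 0 ℤ.* (g 0 ℤ.* h 0)  ≡⟨ sym (trans (⊛-zero f (g ⊛ h)) (cong (f 0 ℤ.*_) (⊛-zero g h))) ⟩
  (f ⊛ (g ⊛ h)) 0    ∎
⊛-assoc f g h (suc n) = begin
  ((f ⊛ g) ⊛ h) (suc n)
    ≡⟨ ⊛-suc (f ⊛ g) h n ⟩
  (f ⊛ g) 0 ℤ.* h (suc n) ℤ.+ (((f ⊛ g) ∘ suc) ⊛ h) n
    ≡⟨ cong₂ ℤ._+_ (cong (ℤ._* h (suc n)) (⊛-zero f g)) (⊛-congˡ h (⊛-suc f g) n) ⟩
  f 0 ℤ.* g 0 ℤ.* h (suc n) ℤ.+ ((λ i → f 0 ℤ.* g (suc i) ℤ.+ ((f ∘ suc) ⊛ g) i) ⊛ h) n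
    ≡⟨ cong (λ t → f 0 ℤ.* g 0 ℤ.* h (suc n) ℤ.+ t) (⊛-linearˡ (f 0) (g ∘ suc) ((f ∘ suc) ⊛ g) h n) ⟩
  f 0 ℤ.* g 0 ℤ.* h (suc n) ℤ.+ (f 0 ℤ.* ((g ∘ suc) ⊛ h) n ℤ.+ (((f ∘ suc) ⊛ g) ⊛ h) n)
    ≡⟨ cong (λ t → f 0 ℤ.* g 0 ℤ.* h (suc n) ℤ.+ (f 0 ℤ.* ((g ∘ suc) ⊛ h) n ℤ.+ t)) (⊛-assoc (f ∘ suc) g h n) ⟩
  f 0 ℤ.* g 0 ℤ.* h (suc n) ℤ.+ (f 0 ℤ.* ((g ∘ suc) ⊛ h) n ℤ.+ ((f ∘ suc) ⊛ (g ⊛ h)) n)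
    ≡⟨ rearrange (f 0) (g 0) (h (suc n)) _ _ ⟩
  f 0 ℤ.* (g 0 ℤ.* h (suc n) ℤ.+ ((g ∘ suc) ⊛ h) n) ℤ.+ ((f ∘ suc) ⊛ (g ⊛ h)) n
    ≡⟨ cong (λ t → f 0 ℤ.* t ℤ.+ ((f ∘ suc) ⊛ (g ⊛ h)) n) (sym (⊛-suc g h n)) ⟩
  f 0 ℤ.* (g ⊛ h) (suc n) ℤ.+ ((f ∘ suc) ⊛ (g ⊛ h)) n
    ≡⟨ sym (⊛-suc f (g ⊛ h) n) ⟩
  (f ⊛ (g ⊛ h)) (suc n) ∎
  where
  rearrange : ∀ x y z s t → x ℤ.* y ℤ.* z ℤ.+ (x ℤ.* s ℤ.+ t) ≡ x ℤ.* (y ℤ.* z ℤ.+ s) ℤ.+ t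
  rearrange = ℤSolver.solve-∀

⊛-shiftˡ : ∀ f g n → (shiftX f ⊛ g) n ≡ shiftX (f ⊛ g) n
⊛-shiftˡ f g zero = ⊛-zero (shiftX f) g
⊛-shiftˡ f g (suc n) = trans (⊛-suc (shiftX f) g n) (ℤ.+-identityˡ _)

⊛-subˡ : ∀ f g h n → ((λ i → f i ℤ.- g i) ⊛ h) n ≡ (f ⊛ h) n ℤ.- (g ⊛ h) n
⊛-subˡ f g h n = begin
  ((λ i → f i ℤ.- g i) ⊛ h) n            ≡⟨ ⊛-congˡ h (λ i → swap (f i) (g i)) n ⟩
  ((λ i → -1ℤ ℤ.* g i ℤ.+ f i) ⊛ h) n      ≡⟨ ⊛-linearˡ -1ℤ g f h n ⟩
  -1ℤ ℤ.* (g ⊛ h) n ℤ.+ (f ⊛ h) n          ≡⟨ sym (swap ((f ⊛ h) n) ((g ⊛ h) n)) ⟩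
  (f ⊛ h) n ℤ.- (g ⊛ h) n                ∎
  where
  swap : ∀ x y → x ℤ.- y ≡ -1ℤ ℤ.* y ℤ.+ x
  swap = ℤSolver.solve-∀

⊛-addˡ : ∀ f g h n → ((f ⊕ g) ⊛ h) n ≡ (f ⊛ h) n ℤ.+ (g ⊛ h) n
⊛-addˡ f g h n = begin
  ((f ⊕ g) ⊛ h) n                 ≡⟨ ⊛-congˡ h (λ i → cong (ℤ._+ g i) (sym (ℤ.*-identityˡ (f i)))) n ⟩
  ((λ i → 1ℤ ℤ.* f i ℤ.+ g i) ⊛ h) n  ≡⟨ ⊛-linearˡ 1ℤ f g h n ⟩
  1ℤ ℤ.* (f ⊛ h) n ℤ.+ (g ⊛ h) n      ≡⟨ cong (ℤ._+ (g ⊛ h) n) (ℤ.*-identityˡ ((f ⊛ h) n)) ⟩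
  (f ⊛ h) n ℤ.+ (g ⊛ h) n           ∎

⊛-oneˡ : ∀ g n → (oneS ⊛ g) n ≡ g n
⊛-oneˡ g zero = trans (⊛-zero oneS g) (ℤ.*-identityˡ (g 0))
⊛-oneˡ g (suc n) = begin
  (oneS ⊛ g) (suc n)                            ≡⟨ ⊛-suc oneS g n ⟩
  1ℤ ℤ.* g (suc n) ℤ.+ ((λ _ → 0ℤ) ⊛ g) n            ≡⟨ cong₂ ℤ._+_ (ℤ.*-identityˡ (g (suc n))) (sum-upTo-zero _ (λ _ → refl) (suc n)) ⟩
  g (suc n) ℤ.+ 0ℤ                                ≡⟨ ℤ.+-identityʳ _ ⟩
  g (suc n)                                     ∎

shiftX-cong : (∀ n → f n ≡ g n) → ∀ n → shiftX f n ≡ shiftX g n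
shiftX-cong f≡g zero = refl
shiftX-cong f≡g (suc n) = f≡g n

oneMinusX-⊛ : ∀ g n → (oneMinusX ⊛ g) n ≡ g n ℤ.- shiftX g n
oneMinusX-⊛ g n = begin
  (oneMinusX ⊛ g) n                              ≡⟨ ⊛-congˡ g 1-x n ⟩
  ((λ i → oneS i ℤ.- shiftX oneS i) ⊛ g) n         ≡⟨ ⊛-subˡ oneS (shiftX oneS) g n ⟩
  (oneS ⊛ g) n ℤ.- (shiftX oneS ⊛ g) n
    ≡⟨ cong₂ ℤ._-_ (⊛-oneˡ g n) (trans (⊛-shiftˡ oneS g n) (shiftX-cong (⊛-oneˡ g) n)) ⟩
  g n ℤ.- shiftX g n                               ∎
  where
  1-x : ∀ i → oneMinusX i ≡ oneS i ℤ.- shiftX oneS i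
  1-x zero = refl
  1-x (suc zero) = refl
  1-x (suc (suc i)) = refl

-- Multiplication by `x^j`, as an iterated shift so that it computes on coefficients; `xPow≡shiftBy`
-- links it to the monomial.
shiftBy : ℕ → Series → Series
shiftBy zero f = f
shiftBy (suc j) f = shiftX (shiftBy j f)

shiftBy-cong : ∀ j → (∀ n → f n ≡ g n) → ∀ n → shiftBy j f n ≡ shiftBy j g n
shiftBy-cong zero f≡g = f≡g
shiftBy-cong (suc j) f≡g = shiftX-cong (shiftBy-cong j f≡g)

shiftBy-⊛ : ∀ j f g n → (shiftBy j f ⊛ g) n ≡ shiftBy j (f ⊛ g) n
shiftBy-⊛ zero f g n = refl
shiftBy-⊛ (suc j) f g n = trans (⊛-shiftˡ (shiftBy j f) g n) (shiftX-cong (shiftBy-⊛ j f g) n)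

shiftBy-+ : ∀ i j f n → shiftBy i (shiftBy j f) n ≡ shiftBy (i + j) f n
shiftBy-+ zero j f n = refl
shiftBy-+ (suc i) j f n = shiftX-cong (shiftBy-+ i j f) n

xPow≡shiftBy : ∀ j n → xPow j n ≡ shiftBy j oneS n
xPow≡shiftBy zero zero = refl
xPow≡shiftBy zero (suc n) = refl
xPow≡shiftBy (suc j) zero = refl
xPow≡shiftBy (suc j) (suc n) = xPow≡shiftBy j n

-- The series `x^j / (1 - x)^(j+1)`, as `binomials-⊛` shows.
binomials : ℕ → Series
binomials j n = ℤ.+ (n C j)

binomials-step : ∀ j n → (oneMinusX ⊛ binomials (suc j)) n ≡ shiftX (binomials j) n
binomials-step j zero = trans (oneMinusX-⊛ (binomials (suc j)) 0)
  (trans (ℤ.+-identityʳ (+ (0 C suc j))) (cong +_ (k>n⇒nCk≡0 {0} {suc j} (s≤s z≤n))))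
binomials-step j (suc n) = begin
  (oneMinusX ⊛ binomials (suc j)) (suc n)   ≡⟨ oneMinusX-⊛ (binomials (suc j)) (suc n) ⟩
  + (suc n C suc j) ℤ.- + (n C suc j)         ≡⟨ cong (λ c → + c ℤ.- + (n C suc j)) (sym (nCk+nC[k+1]≡[n+1]C[k+1] n j)) ⟩
  + (n C j) ℤ.+ + (n C suc j) ℤ.- + (n C suc j) ≡⟨ cancel (+ (n C j)) (+ (n C suc j)) ⟩
  + (n C j)                                 ∎
  where
  cancel : ∀ x y → x ℤ.+ y ℤ.- y ≡ x
  cancel = ℤSolver.solve-∀

binomials-base : ∀ n → (oneMinusX ⊛ binomials 0) n ≡ oneS n
binomials-base zero = oneMinusX-⊛ (binomials 0) 0
binomials-base (suc n) = oneMinusX-⊛ (binomials 0) (suc n)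

-- One factor `1 - x` at a time is moved next to `binomials`, where Pascal's rule trades it for a
-- factor `x` and a lower index; the last factor meets the geometric series.
binomials-⊛ : ∀ j n → (binomials j ⊛ powS oneMinusX (suc j)) n ≡ shiftBy j oneS n
binomials-⊛ j n = begin
  (binomials j ⊛ (oneMinusX ⊛ powS oneMinusX j)) n ≡⟨ sym (⊛-assoc (binomials j) oneMinusX (powS oneMinusX j) n) ⟩
  ((binomials j ⊛ oneMinusX) ⊛ powS oneMinusX j) n ≡⟨ ⊛-congˡ (powS oneMinusX j) (⊛-comm (binomials j) oneMinusX) n ⟩
  ((oneMinusX ⊛ binomials j) ⊛ powS oneMinusX j) n ≡⟨ reduce j ⟩
  shiftBy j oneS n                                 ∎
  where
  reduce : ∀ j → ((oneMinusX ⊛ binomials j) ⊛ powS oneMinusX j) n ≡ shiftBy j oneS n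
  reduce zero = trans (⊛-congˡ oneS binomials-base n) (⊛-oneˡ oneS n)
  reduce (suc j) = begin
    ((oneMinusX ⊛ binomials (suc j)) ⊛ powS oneMinusX (suc j)) n
      ≡⟨ ⊛-congˡ (powS oneMinusX (suc j)) (binomials-step j) n ⟩
    (shiftX (binomials j) ⊛ powS oneMinusX (suc j)) n
      ≡⟨ ⊛-shiftˡ (binomials j) (powS oneMinusX (suc j)) n ⟩
    shiftX (binomials j ⊛ powS oneMinusX (suc j)) n
      ≡⟨ shiftX-cong (binomials-⊛ j) n ⟩
    shiftBy (suc j) oneS n ∎

-- The recurrence of `Ŭ` is Pascal's rule along diagonals. For `j > r` the truncated difference is 0
-- and `0 C j` vanishes, so the formula stays right beyond the degree.
Ŭ-coefficient : ∀ r j → Ŭ r j ≡ -1ℤ ℤ.^ j ℤ.* + ((r ∸ j) C j)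
Ŭ-coefficient zero zero = refl
Ŭ-coefficient zero (suc j) = sym (trans (cong (λ c → -1ℤ ℤ.^ suc j ℤ.* + c) (k>n⇒nCk≡0 {0} {suc j} (s≤s z≤n))) (ℤ.*-zeroʳ (-1ℤ ℤ.^ suc j)))
Ŭ-coefficient (suc zero) zero = refl
Ŭ-coefficient (suc zero) (suc j) = sym (trans (cong (λ c → -1ℤ ℤ.^ suc j ℤ.* + c)
  (trans (cong (_C suc j) (0∸n≡0 j)) (k>n⇒nCk≡0 {0} {suc j} (s≤s z≤n)))) (ℤ.*-zeroʳ (-1ℤ ℤ.^ suc j)))
Ŭ-coefficient (suc (suc r)) zero = trans (ℤ.+-identityʳ (Ŭ (suc r) 0)) (Ŭ-coefficient (suc r) 0)
Ŭ-coefficient (suc (suc r)) (suc i) = begin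
  Ŭ (suc r) (suc i) ℤ.- Ŭ r i
    ≡⟨ cong₂ ℤ._-_ (Ŭ-coefficient (suc r) (suc i)) (Ŭ-coefficient r i) ⟩
  -1ℤ ℤ.* -1ℤ ℤ.^ i ℤ.* + ((r ∸ i) C suc i) ℤ.- -1ℤ ℤ.^ i ℤ.* + ((r ∸ i) C i)
    ≡⟨ collect (-1ℤ ℤ.^ i) _ _ ⟩
  -1ℤ ℤ.* -1ℤ ℤ.^ i ℤ.* (+ ((r ∸ i) C i) ℤ.+ + ((r ∸ i) C suc i))
    ≡⟨ cong (λ c → -1ℤ ℤ.^ suc i ℤ.* + c) (pascal r i) ⟩
  -1ℤ ℤ.^ suc i ℤ.* + ((suc r ∸ i) C suc i) ∎
  where
  collect : ∀ e x y → -1ℤ ℤ.* e ℤ.* x ℤ.- e ℤ.* y ≡ -1ℤ ℤ.* e ℤ.* (y ℤ.+ x)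
  collect = ℤSolver.solve-∀
  pascal : ∀ r i → (r ∸ i) C i + (r ∸ i) C suc i ≡ (suc r ∸ i) C suc i
  pascal r i with i ≤? r
  ... | yes i≤r = trans (nCk+nC[k+1]≡[n+1]C[k+1] (r ∸ i) i) (cong (_C suc i) (sym (+-∸-assoc 1 i≤r)))
  ... | no i≰r rewrite m≤n⇒m∸n≡0 (<⇒≤ (≰⇒> i≰r)) | m≤n⇒m∸n≡0 (≰⇒> i≰r)
    | k>n⇒nCk≡0 {0} {i} (≤-<-trans z≤n (≰⇒> i≰r)) = refl

Ŭ-vanishes : ∀ r j → r < j → Ŭ r j ≡ 0ℤ
Ŭ-vanishes r j r<j = trans (Ŭ-coefficient r j) (trans
  (cong (λ c → -1ℤ ℤ.^ j ℤ.* + c) (trans (cong (_C j) (m≤n⇒m∸n≡0 (<⇒≤ r<j))) (k>n⇒nCk≡0 (≤-<-trans z≤n r<j))))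
  (ℤ.*-zeroʳ (-1ℤ ℤ.^ j)))

shiftBy-< : ∀ j f n → n < j → shiftBy j f n ≡ 0ℤ
shiftBy-< (suc j) f zero _ = refl
shiftBy-< (suc j) f (suc n) (s≤s n<j) = shiftBy-< j f n n<j

shiftBy-≥ : ∀ j f i → shiftBy j f (j + i) ≡ f i
shiftBy-≥ zero f i = refl
shiftBy-≥ (suc j) f i = shiftBy-≥ j f i

-- Ballot numbers

-- Counts lattice paths with `r + s` up-steps and `s` down-steps that never go below 0, by their
-- last step. The same clauses govern the coefficient of `x^(r+s)` in `h r`, see `h-ballot`.
ballot : ℕ → ℕ → ℕ
ballot r zero = 1
ballot zero (suc s) = ballot 1 s
ballot (suc r) (suc s) = ballot (suc (suc r)) s + ballot r (suc s)

-- The binomial `n C (s - 1)` with value 0 at `s = 0`, where truncated subtraction would give 1.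
_C⁻_ : ℕ → ℕ → ℕ
n C⁻ zero = 0
n C⁻ suc s = n C s

pascal : ∀ n s → n C⁻ s + n C s ≡ suc n C s
pascal n zero = refl
pascal n (suc s) = nCk+nC[k+1]≡[n+1]C[k+1] n s

C-middle : ∀ s → suc (s + s) C s ≡ suc (s + s) C suc s
C-middle s = trans (nCk≡nC[n∸k] (m≤n⇒m≤1+n (m≤m+n s s))) (cong (suc (s + s) C_) (m+n∸n≡m (suc s) s))

-- The reflection formula for paths of length `r + 2s`, with its subtraction moved to the other
-- side. At `r = 0` the symmetry `C-middle` stands in for the missing neighbour `r - 1`.
ballot-closed : ∀ r s → ballot r s + (r + (s + s)) C⁻ s ≡ (r + (s + s)) C s
ballot-closed r zero = refl
ballot-closed zero (suc s) = begin
  ballot 1 s + suc (s + suc s) C s                 ≡⟨ cong (λ e → ballot 1 s + suc e C s) (+-suc s s) ⟩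
  ballot 1 s + suc (suc (s + s)) C s               ≡⟨ cong (_+_ (ballot 1 s)) (sym (pascal (suc (s + s)) s)) ⟩
  ballot 1 s + (suc (s + s) C⁻ s + suc (s + s) C s) ≡⟨ sym (+-assoc (ballot 1 s) _ _) ⟩
  ballot 1 s + suc (s + s) C⁻ s + suc (s + s) C s  ≡⟨ cong₂ _+_ (ballot-closed 1 s) (C-middle s) ⟩
  suc (s + s) C s + suc (s + s) C suc s            ≡⟨ pascal (suc (s + s)) (suc s) ⟩
  suc (suc (s + s)) C suc s                        ≡⟨ cong (λ e → suc e C suc s) (sym (+-suc s s)) ⟩
  suc (s + suc s) C suc s                          ∎
ballot-closed (suc r) (suc s) = begin
  ballot (2 + r) s + ballot r (suc s) + suc N C s
    ≡⟨ cong (_+_ (ballot (2 + r) s + ballot r (suc s))) (sym (pascal N s)) ⟩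
  ballot (2 + r) s + ballot r (suc s) + (N C⁻ s + N C s)
    ≡⟨ interchange (ballot (2 + r) s) _ _ _ ⟩
  (ballot (2 + r) s + N C⁻ s) + (ballot r (suc s) + N C s)
    ≡⟨ cong₂ _+_ (subst (λ e → ballot (2 + r) s + e C⁻ s ≡ e C s) N≡ (ballot-closed (2 + r) s)) (ballot-closed r (suc s)) ⟩
  N C s + N C suc s
    ≡⟨ pascal N (suc s) ⟩
  suc N C suc s ∎
  where
  N = r + (suc s + suc s)
  N≡ : 2 + r + (s + s) ≡ N
  N≡ = shuffle r s
    where
    shuffle : ∀ r s → 2 + r + (s + s) ≡ r + (suc s + suc s)
    shuffle = ℕSolver.solve-∀
  interchange : ∀ a b c d → a + b + (c + d) ≡ (a + c) + (b + d)
  interchange = ℕSolver.solve-∀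

absorption : ∀ n s → suc s * (suc n C suc s) ≡ suc n * (n C s)
absorption zero zero = refl
absorption zero (suc s) = trans (cong (suc (suc s) *_) (k>n⇒nCk≡0 {1} {suc (suc s)} (s≤s (s≤s z≤n))))
  (trans (*-zeroʳ (suc (suc s))) (sym (trans (*-identityˡ (0 C suc s)) (k>n⇒nCk≡0 {0} {suc s} (s≤s z≤n)))))
absorption (suc n) zero = trans (*-identityˡ (suc (suc n) C 1)) (trans (nC1≡n (suc (suc n))) (sym (*-identityʳ (suc (suc n)))))
absorption (suc n) (suc s) = begin
  suc (suc s) * (suc (suc n) C suc (suc s))
    ≡⟨ cong (suc (suc s) *_) (sym (pascal (suc n) (suc (suc s)))) ⟩
  suc (suc s) * (suc n C suc s + suc n C suc (suc s))
    ≡⟨ *-distribˡ-+ (suc (suc s)) (suc n C suc s) _ ⟩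
  suc n C suc s + suc s * (suc n C suc s) + suc (suc s) * (suc n C suc (suc s))
    ≡⟨ cong₂ (λ a b → suc n C suc s + a + b) (absorption n s) (absorption n (suc s)) ⟩
  suc n C suc s + suc n * (n C s) + suc n * (n C suc s)
    ≡⟨ collect (suc n C suc s) (suc n) (n C s) (n C suc s) ⟩
  suc n C suc s + suc n * (n C s + n C suc s)
    ≡⟨ cong (λ a → suc n C suc s + suc n * a) (pascal n (suc s)) ⟩
  suc (suc n) * (suc n C suc s) ∎
  where
  collect : ∀ a b c d → a + b * c + b * d ≡ a + b * (c + d)
  collect = ℕSolver.solve-∀

-- The instance n = 2t+2, s = t of (s+1) C(n, s+1) = (n−s) C(n, s).
C-next-to-middle : ∀ t → suc t * ((2 + (t + t)) C suc t) ≡ (2 + t) * ((2 + (t + t)) C t)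
C-next-to-middle t = +-cancelʳ-≡ (suc t * (N C t)) _ _ (begin
  suc t * (N C suc t) + suc t * (N C t)  ≡⟨ +-comm (suc t * (N C suc t)) _ ⟩
  suc t * (N C t) + suc t * (N C suc t)  ≡⟨ sym (*-distribˡ-+ (suc t) (N C t) _) ⟩
  suc t * (N C t + N C suc t)            ≡⟨ cong (suc t *_) (pascal N (suc t)) ⟩
  suc t * (suc N C suc t)                ≡⟨ absorption N t ⟩
  suc N * (N C t)                        ≡⟨ regroup t (N C t) ⟩
  (2 + t) * (N C t) + suc t * (N C t)    ∎)
  where
  N = 2 + (t + t)
  regroup : ∀ t c → suc (2 + (t + t)) * c ≡ (2 + t) * c + suc t * c
  regroup = ℕSolver.solve-∀

-- The quotient is exact: `scaled` multiplies the closed form by `suc n`, where `C-next-to-middle`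
-- merges its two binomials into one.
ballot-catalan : ∀ n → ballot 0 n ≡ ((2 * n) C n) / suc n
ballot-catalan n = trans (sym (m*n/n≡m (ballot 0 n) (suc n))) (cong (_/ suc n) (scaled n))
  where
  double : ∀ t → 2 + (t + t) ≡ 2 * suc t
  double = ℕSolver.solve-∀
  scaled : ∀ n → ballot 0 n * suc n ≡ (2 * n) C n
  scaled zero = refl
  scaled (suc t) = +-cancelʳ-≡ ((2 + t) * (N C t)) _ _ (begin
    c₀ * (2 + t) + (2 + t) * (N C t)         ≡⟨ factor c₀ (2 + t) (N C t) ⟩
    (2 + t) * (c₀ + N C t)                   ≡⟨ cong ((2 + t) *_) (subst (λ e → c₀ + e C t ≡ e C suc t) (cong suc (+-suc t t)) (ballot-closed 0 (suc t))) ⟩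
    (2 + t) * (N C suc t)                   ≡⟨ cong (_+_ (N C suc t)) (C-next-to-middle t) ⟩
    N C suc t + (2 + t) * (N C t)           ≡⟨ cong (λ e → e C suc t + (2 + t) * (N C t)) (double t) ⟩
    (2 * suc t) C suc t + (2 + t) * (N C t) ∎)
    where
    N = 2 + (t + t)
    c₀ = ballot 0 (suc t)
    factor : ∀ b c e → b * c + c * e ≡ c * (b + e)
    factor = ℕSolver.solve-∀

-- `Ŭ` with its index lowered by one and `U` at index -1 equal to 0, so that the recurrence `Ŭ-suc`
-- includes `r = 0`.
Ŭ⁻ : ℕ → Series
Ŭ⁻ zero n = 0ℤ
Ŭ⁻ (suc r) = Ŭ r

Ŭ-suc : ∀ r n → Ŭ (suc r) n ≡ Ŭ r n ℤ.- shiftX (Ŭ⁻ r) n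
Ŭ-suc zero zero = refl
Ŭ-suc zero (suc n) = refl
Ŭ-suc (suc r) n = refl

-- The recursion for H p q

-- The parameters are the predecessors of `m = k - 1 - d` and `d`: both are positive exactly when
-- `1 ≤ d ≤ k - 2`.
module Avoidance (m′ d′ : ℕ) where

  m d k : ℕ
  m = suc m′
  d = suc d′
  k = suc (m + d)

  X : List (List ℕ)
  X = X¹ k d

  Avoids : List ℕ → Set
  Avoids α = ∀ {τ} → τ ∈ X → ¬ Contains α τ

  patTail : ℕ → List ℕ
  patTail j = interval 1 j ++ k ∷ interval (suc j) (d ∸ j)

  pat≡ : ∀ j → pat k d j ≡ interval (suc d) m ++ patTail j
  pat≡ j = cong (λ i → interval (suc d) i ++ patTail j) (m+n∸n≡m m d)

  avoids-321 : Avoids α → ∀ {a b c} → a ∷ b ∷ c ∷ [] ⊆ α → b < a → ¬ c < b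
  avoids-321 av s b<a c<b = av (here refl) (⇒Contains321 s b<a c<b)

  avoids-pat : Avoids α → ∀ {j} → j ≤ d → ¬ Contains α (interval (suc d) m ++ patTail j)
  avoids-pat {α} av {j} j≤d c = av (there (∈-map⁺ (pat k d) (∈-upTo⁺ (s≤s j≤d)))) (subst (Contains α) (sym (pat≡ j)) c)

  avoids⁺ : (∀ {a b c} → a ∷ b ∷ c ∷ [] ⊆ α → b < a → ¬ c < b) →
    (∀ {j} → j ≤ d → ¬ Contains α (interval (suc d) m ++ patTail j)) → Avoids α
  avoids⁺ no321 nopat (here refl) c with _ , _ , _ , s , b<a , c<b ← Contains321⇒ c = no321 s b<a c<b
  avoids⁺ {α} no321 nopat (there τ∈) c with j , j∈ , refl ← ∈-map⁻ (pat k d) τ∈ =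
    nopat (s≤s⁻¹ (∈-upTo⁻ j∈)) (subst (Contains α) (pat≡ j) c)

  avoids-⊆ : β ⊆ α → Avoids α → Avoids β
  avoids-⊆ β⊆α av τ∈ c = av τ∈ (Contains-⊆ β⊆α c)

  avoids-inc⁺ : ∀ q → Avoids β → Avoids (map (inc q) β)
  avoids-inc⁺ q av τ∈ c = av τ∈ (Contains-map⁻ (inc-mono-< q) c)

  avoids-inc⁻ : ∀ q → Avoids (map (inc q) β) → Avoids β
  avoids-inc⁻ q av τ∈ c = av τ∈ (Contains-map⁺ (inc-mono-< q) c)

  -- The clause `q ≤ length α` makes `H p q n` vanish for `q > n`, as `Split` does for `p > n`.
  Class : ℕ → ℕ → List ℕ → Set
  Class p q α = Split p (Shape q) α × q ≤ length α × T (avoidsAll X α)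

  class? : ∀ p q α → Dec (Class p q α)
  class? p q α = split? p (shape? q) α ×-dec q ≤? length α ×-dec Bool.T? (avoidsAll X α)

  H : ℕ → ℕ → ℕ → ℕ
  H p q n = count (class? p q) (perms n)

  avoids : T (avoidsAll X α) → Avoids α
  avoids {α} = avoidsAll⇒ X α

  -- All letters of `us` exceed `q`, so pairs meeting `us` fulfil `Ord q` vacuously.
  shape-ord : ∀ us → Shape q us vs → AllPairs (Ord q) (us ++ vs)
  shape-ord {q} {vs} us (_ , big , ord) = pairs⁺ λ s x≤q y≤q → go (++⊆⁻ us s) x≤q y≤q
    where
    go : ∃₂ (λ s₁ s₂ → x ∷ y ∷ [] ≡ s₁ ++ s₂ × s₁ ⊆ us × s₂ ⊆ vs) → Ord q x y
    go ([] , _ , refl , _ , s₂⊆) x≤q y≤q = pairs⁻ ord s₂⊆ x≤q y≤q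
    go (_ ∷ _ , _ , eq , s₁⊆ , _) x≤q _ =
      contradiction (All.lookup big (⊆-∈ s₁⊆ (here (proj₁ (∷-injective eq))))) (≤⇒≯ x≤q)

  -- A new first letter suc q ≤ d is too small to be the first letter d+1 of a long pattern.
  avoids-cons : IsPerm n (suc q ∷ β) → suc q ≤ d → AllPairs (Ord q) β → Avoids β → Avoids (suc q ∷ β)
  avoids-cons {q = q} {β} P q<d ord av = avoids⁺ no321 nopat
    where
    no321 : ∀ {a b c} → a ∷ b ∷ c ∷ [] ⊆ suc q ∷ β → b < a → ¬ c < b
    no321 (_ ∷ʳ s) = avoids-321 av s
    -- If `suc q` plays the 3, the other two letters are at most `q` and hence occur in increasing
    -- order.
    no321 (refl ∷ s) (s≤s b≤q) c<b = <-asym c<b (pairs⁻ ord s b≤q (≤-trans (<⇒≤ c<b) b≤q))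
    nopat : ∀ {j} → j ≤ d → ¬ Contains (suc q ∷ β) (interval (suc d) m ++ patTail j)
    nopat j≤d (s , _ ∷ʳ s⊆ , eq) = avoids-pat av j≤d (s , s⊆ , eq)
    nopat j≤d (s@(_ ∷ t) , s⊆@(refl ∷ _) , eq) = <-irrefl refl (≤-trans
      (≤-reflexive (trans (sym (+-identityʳ (suc d))) (sym (proj₁ (∷-injective eq)))))
      (≤-trans (rank≤ (⊆-unique s⊆ (unique P)) (Sublist.All-resp-⊆ s⊆ (positive P)) (s≤s z≤n)) q<d))

  -- At an index below m, the letter 1 cannot play the 1 of a long pattern, which has m letters before it.
  avoids-insert1 : ∀ us {vs} → length us < m → AllPairs _<_ us → All (1 ≤_) (us ++ 1 ∷ vs) →
    Avoids (us ++ vs) → Avoids (us ++ 1 ∷ vs)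
  avoids-insert1 us {vs} len up pos av = avoids⁺ no321 nopat
    where
    no321 : ∀ {a b c} → a ∷ b ∷ c ∷ [] ⊆ us ++ 1 ∷ vs → b < a → ¬ c < b
    -- As the smallest letter, 1 cannot play the 3 or the 2; if it plays the 1, both letters before
    -- it lie in the increasing word `us`.
    no321 s b<a c<b with ⊆-insert⁻ us s
    ... | inj₁ s′ = avoids-321 av s′ b<a c<b
    ... | inj₂ ([] , _ , refl , _ , _) = contradiction (≤-trans c<b (s≤s⁻¹ b<a)) λ ()
    ... | inj₂ (_ ∷ [] , _ , refl , _ , _) =
      <-irrefl refl (≤-trans c<b (All.lookup pos (⊆-∈ s (there (there (here refl))))))
    ... | inj₂ (_ ∷ _ ∷ [] , _ , refl , s₁ , _) = <-asym b<a (pairs⁻ up s₁)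
    ... | inj₂ (_ ∷ _ ∷ _ ∷ [] , _ , () , _ , _)
    ... | inj₂ (_ ∷ _ ∷ _ ∷ _ ∷ _ , _ , () , _ , _)
    nopat : ∀ {j} → j ≤ d → ¬ Contains (us ++ 1 ∷ vs) (interval (suc d) m ++ patTail j)
    nopat {j} j≤d (s , s⊆ , eq) with ⊆-insert⁻ us s⊆
    ... | inj₁ s⊆′ = avoids-pat av j≤d (s , s⊆′ , eq)
    ... | inj₂ (s₁ , s₂ , refl , s₁⊆ , _) = contradiction (proj₁ (∈-interval⁻ {suc d} {m} 1∈)) λ { (s≤s ()) }
      where
      rank1 : rank s 1 ≡ 1
      rank1 = cong suc (countLess-none (Sublist.All-resp-⊆ s⊆ pos))
      1∈ : 1 ∈ interval (suc d) m
      1∈ = ++-∈-prefix (map (rank s) s₁) (interval (suc d) m)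
        (trans (sym (trans (map-++ (rank s) s₁ (1 ∷ s₂)) (cong (λ r → map (rank s) s₁ ++ r ∷ map (rank s) s₂) rank1))) eq)
        (subst₂ _<_ (sym (length-map (rank s) s₁)) (sym (length-interval (suc d) m))
          (≤-<-trans (Sublist.length-mono-≤ s₁⊆) len))

  -- The prefix increases and exceeds `q`, so `suc q` can only be its first letter, which is what
  -- `a ≟ suc q` tests. The bound `suc q ≤ d` serves `avoids-cons`.
  H-q-step : suc q ≤ d → H (suc p) q (suc n) ≡ H (suc p) (suc q) (suc n) + H p q n
  H-q-step {q} {p} {n} q<d = count-split (class? (suc p) q) (class? (suc p) (suc q)) (class? p q)
    (λ β → suc q ∷ map (inc (suc q)) β) (cons-inc-injective (suc q)) (perms-unique (suc n)) (perms-unique n)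
    splits weaken inserts
    where
    splits : α ∈ perms (suc n) → Class (suc p) q α →
      Class (suc p) (suc q) α ⊎ ∃[ β ] β ∈ perms n × Class p q β × α ≡ suc q ∷ map (inc (suc q)) β
    splits α∈ ((a ∷ us , vs , refl , l , a< ∷ up , q<a ∷ big , ord) , q≤ , av) with a ≟ suc q
    ... | yes refl with [] , β , refl , eq , P ← IsPerm-insert⁻ [] (∈perms⇒IsPerm (suc n) α∈)
      with us′ , vs′ , refl , refl , refl ← map≡++⁻ (inc (suc q)) β {us} {vs} (sym eq) = inj₂
      ( us′ ++ vs′ , IsPerm⇒∈perms n P
      , ( ( us′ , vs′ , refl , trans (sym (length-map (inc (suc q)) us′)) (suc-injective l)
          , inc-increasing⁻ (suc q) up
          , All.map (λ {u} lt → s≤s⁻¹ (≤-trans lt (inc≤suc (suc q) u))) (All.map⁻ a<)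
          , AllPairs.map (λ {x} {y} o x≤q y≤q → inc-cancel-< (suc q)
              (o (subst (_≤ q) (sym (inc-< (s≤s x≤q))) x≤q) (subst (_≤ q) (sym (inc-< (s≤s y≤q))) y≤q)))
              (AllPairs.map⁻ ord))
        , subst (q ≤_) (sym (len P)) (s≤s⁻¹ (≤n (∈perms⇒IsPerm (suc n) α∈) (here refl)))
        , ⇒avoidsAll X _ (avoids-inc⁻ (suc q) (subst Avoids eq (avoids-⊆ (_ ∷ʳ ⊆-refl) (avoids av)))))
      , cong (suc q ∷_) eq )
    ... | no a≢ = inj₁
      ( (a ∷ us , vs , refl , l , a< ∷ up , q+1<a ∷ All.map (<-trans q+1<a) a< , pairs⁺ ord′)
      , subst (suc q ≤_) (sym (len P)) (≤-trans q<a (≤n P (here refl))) , av)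
      where
      P = ∈perms⇒IsPerm (suc n) α∈
      q+1<a : suc q < a
      q+1<a = ≤∧≢⇒< q<a (a≢ ∘ sym)
      ord′ : x ∷ y ∷ [] ⊆ vs → Ord (suc q) x y
      ord′ {x} {y} s x≤ y≤ with m≤n⇒m<n∨m≡n x≤ | m≤n⇒m<n∨m≡n y≤
      ... | inj₁ (s≤s x≤q) | inj₁ (s≤s y≤q) = pairs⁻ ord s x≤q y≤q
      ... | inj₁ x<        | inj₂ refl = x<
      -- If `suc q` stood in front of a smaller `y`, then `a`, `suc q`, `y` would form a 321.
      ... | inj₂ refl      | inj₁ y< = contradiction y<
              (avoids-321 (avoids av) (refl ∷ Sublist.++⁺ (minimum us) s) q+1<a)
      ... | inj₂ refl      | inj₂ refl = contradiction refl
              (pairs⁻ (unique P) (a ∷ʳ Sublist.++⁺ (minimum us) s))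

    weaken : α ∈ perms (suc n) → Class (suc p) (suc q) α → Class (suc p) q α
    weaken _ ((us , vs , eq , l , up , big , ord) , q≤ , av) =
      (us , vs , eq , l , up , All.map <⇒≤ big , AllPairs.map (λ o x≤ y≤ → o (m≤n⇒m≤1+n x≤) (m≤n⇒m≤1+n y≤)) ord) , <⇒≤ q≤ , av

    inserts : β ∈ perms n → Class p q β → suc q ∷ map (inc (suc q)) β ∈ perms (suc n) ×
      Class (suc p) q (suc q ∷ map (inc (suc q)) β) × ¬ Class (suc p) (suc q) (suc q ∷ map (inc (suc q)) β)
    inserts {β} β∈ ((us , vs , refl , l , up , big , ord) , q≤ , av) = fβ∈
      , ( ( suc q ∷ map (inc (suc q)) us , map (inc (suc q)) vs
          , cong (suc q ∷_) (map-++ (inc (suc q)) us vs) , cong suc (trans (length-map _ us) l)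
          , All.map⁺ (All.map (λ q<u → subst (suc q <_) (sym (inc-≥ q<u)) (s≤s q<u)) big) ∷ inc-increasing (suc q) up
          , ≤-refl ∷ All.map⁺ (All.map (λ {u} q<u → ≤-trans q<u (≤inc (suc q) u)) big)
          , AllPairs.map⁺ (AllPairs.map inc-ord ord))
        , subst (q ≤_) (sym (len P′)) (<⇒≤ q≤n)
        , ⇒avoidsAll X _ (avoids-cons P′ q<d (AllPairs.map⁺ (AllPairs.map inc-ord (shape-ord us (up , big , ord))))
            (avoids-inc⁺ (suc q) (avoids av))))
      , λ { ((_ ∷ _ , _ , eq , _ , _ , lt ∷ _ , _) , _) → <-irrefl (proj₁ (∷-injective eq)) lt }
      where
      P = ∈perms⇒IsPerm n β∈
      q≤n : suc q ≤ suc n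
      q≤n = s≤s (subst (q ≤_) (len P) q≤)
      fβ∈ = IsPerm-cons⁺ (s≤s z≤n) q≤n β∈
      P′ = ∈perms⇒IsPerm (suc n) fβ∈
      inc-ord : Ord q x y → Ord q (inc (suc q) x) (inc (suc q) y)
      inc-ord {x} {y} o x≤ y≤ = inc-mono-< (suc q) (o (≤-trans (≤inc (suc q) x) x≤) (≤-trans (≤inc (suc q) y) y≤))

  -- Let `b` be the letter at index `p`. Either `b` is the 1, or the 1 stands behind it and `b` can
  -- join the prefix. The bound `suc p ≤ m` serves `avoids-insert1`.
  H-p-step : suc p ≤ m → H p (suc q) (suc n) ≡ H (suc p) (suc q) (suc n) + H p q n
  H-p-step {p} {q} {n} p<m = count-split (class? p (suc q)) (class? (suc p) (suc q)) (class? p q)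
    (insert1 p) (insert1-injective p) (perms-unique (suc n)) (perms-unique n) splits weaken inserts
    where
    splits : α ∈ perms (suc n) → Class p (suc q) α →
      Class (suc p) (suc q) α ⊎ ∃[ β ] β ∈ perms n × Class p q β × α ≡ insert1 p β
    splits α∈ ((us , [] , refl , l , up , big , ord) , q≤ , av)
      with ∈-++⁻ us (IsPerm-full (∈perms⇒IsPerm (suc n) α∈) ≤-refl (s≤s z≤n))
    ... | inj₁ 1∈us = contradiction (All.lookup big 1∈us) λ { (s≤s ()) }
    splits α∈ ((us , b ∷ vs , refl , l , up , big , ord₁ ∷ ord) , q≤ , av)
      with ∈-++⁻ us (IsPerm-full (∈perms⇒IsPerm (suc n) α∈) ≤-refl (s≤s z≤n))
    ... | inj₁ 1∈us = contradiction (All.lookup big 1∈us) λ { (s≤s ()) }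
    ... | inj₂ (here refl)
      with us′ , vs′ , refl , refl , P ← IsPerm-insert⁻ us (∈perms⇒IsPerm (suc n) α∈)
      with refl ← trans (sym (length-map (inc 1) us′)) l
      = inj₂
      ( us′ ++ vs′ , IsPerm⇒∈perms n P
      , ( ( us′ , vs′ , refl , refl
          , inc-increasing⁻ 1 up
          , All.map (λ {u} lt → s≤s⁻¹ (≤-trans lt (inc≤suc 1 u))) (All.map⁻ big)
          , AllPairs.map (λ {x} {y} o x≤q y≤q → inc-cancel-< 1
              (o (≤-trans (inc≤suc 1 x) (s≤s x≤q)) (≤-trans (inc≤suc 1 y) (s≤s y≤q)))) (AllPairs.map⁻ ord))
        , s≤s⁻¹ (subst (suc q ≤_) (trans (len (∈perms⇒IsPerm (suc n) α∈)) (cong suc (sym (len P)))) q≤)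
        , ⇒avoidsAll X _ (avoids-inc⁻ 1 (subst Avoids (sym (map-++ (inc 1) us′ vs′))
            (avoids-⊆ (insert-⊆ (map (inc 1) us′)) (avoids av)))))
      , sym (insert1-++ us′ vs′) )
    ... | inj₂ (there 1∈vs) = inj₁
      ( ( us ++ b ∷ [] , vs , sym (++-assoc us (b ∷ []) vs)
        , trans (length-++ us) (trans (+-comm _ 1) (cong suc l))
        , AllPairs.++⁺ up ([] ∷ []) (All.tabulate λ u∈ → u<b u∈ ∷ [])
        , All.++⁺ big (q<b ∷ []) , ord)
      , q≤ , av )
      where
      P = ∈perms⇒IsPerm (suc n) α∈
      q<b : suc q < b
      -- Otherwise `b` and the 1 behind it are both at most `suc q`, and `Ord` would force `b < 1`.
      q<b = ≰⇒> λ b≤q → <⇒≱ (All.lookup ord₁ 1∈vs b≤q (s≤s z≤n)) (1≤ P (∈-++⁺ʳ us (here refl)))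
      u<b : v ∈ us → v < b
      -- A larger `v` in front of `b` would form a 321 with `b` and the 1.
      u<b v∈ = ≤∧≢⇒< (≮⇒≥ λ b<v → avoids-321 (avoids av) (Sublist.++⁺ (from∈ v∈) (refl ∷ from∈ 1∈vs)) b<v
                        (≤-<-trans (s≤s z≤n) q<b))
                     (pairs⁻ (unique P) (Sublist.++⁺ (from∈ v∈) (refl ∷ minimum vs)))

    weaken : α ∈ perms (suc n) → Class (suc p) (suc q) α → Class p (suc q) α
    weaken _ ((us , vs , refl , l , up , big , ord) , q≤ , av) with initLast us
    weaken _ ((_ , vs , refl , () , up , big , ord) , q≤ , av) | []
    ... | us₀ ∷ʳ′ b =
      ( us₀ , b ∷ vs , ++-assoc us₀ (b ∷ []) vs
      , suc-injective (trans (trans (+-comm 1 _) (sym (length-++ us₀))) l)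
      , pairs⁺ (λ s → pairs⁻ up (⊆-trans s (Sublist.++⁺ʳ (b ∷ []) ⊆-refl)))
      , All.++⁻ˡ us₀ big
      , All.tabulate (λ _ b≤q → contradiction (All.head (All.++⁻ʳ us₀ big)) (≤⇒≯ b≤q)) ∷ ord)
      , q≤ , av

    inserts : β ∈ perms n → Class p q β →
      insert1 p β ∈ perms (suc n) × Class p (suc q) (insert1 p β) × ¬ Class (suc p) (suc q) (insert1 p β)
    inserts β∈ ((us , vs , refl , refl , up , big , ord) , q≤ , av)
      rewrite insert1-++ us vs = fβ∈
      , ( ( us′ , 1 ∷ vs′ , refl , length-map (inc 1) us , inc-increasing 1 up
          , All.map⁺ (All.map (λ q<u → subst (suc q <_) (sym (inc-≥ (≤-trans (s≤s z≤n) q<u))) (s≤s q<u)) big)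
          , All.map (λ 1<v _ _ → 1<v) (inc1-positive vs (All.++⁻ʳ us (positive P)))
            ∷ AllPairs.map⁺ (AllPairs.map (λ o x≤ y≤ → inc-mono-< 1 (o (inc1-≤ x≤) (inc1-≤ y≤))) ord))
        , subst (suc q ≤_) (trans (cong suc (len P)) (sym (len P′))) (s≤s q≤)
        , ⇒avoidsAll X _ (avoids-insert1 us′ (subst (_< m) (sym (length-map (inc 1) us)) p<m)
            (inc-increasing 1 up) (positive P′)
            (subst Avoids (map-++ (inc 1) us vs) (avoids-inc⁺ 1 (avoids av)))))
      -- The 1 stands at index `p`, hence in every prefix of `p + 1` letters, whose letters would
      -- all have to exceed `suc q`.
      , λ { ((us₁ , _ , eq , l₁ , _ , big₁ , _) , _) →
            <⇒≱ (All.lookup big₁ (++-∈-prefix us′ us₁ eq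
              (subst (suc (length us′) ≤_) (sym l₁) (≤-reflexive (cong suc (length-map (inc 1) us)))))) (s≤s z≤n) }
      where
      us′ = map (inc 1) us
      vs′ = map (inc 1) vs
      P = ∈perms⇒IsPerm n β∈
      P′ = IsPerm-insert⁺ us ≤-refl (s≤s z≤n) P
      fβ∈ = IsPerm⇒∈perms (suc n) P′

  -- The top of the recursion: p = m and q = d

  std-pattern : ∀ us {n j} → length us ≡ m → AllPairs _<_ us → All (d <_) us → All (_< n) us → d < n → j ≤ d →
    std (us ++ interval 1 j ++ n ∷ interval (suc j) (d ∸ j)) ≡ interval (suc d) m ++ patTail j
  std-pattern us {n} {j} l up big small d<n j≤d = begin
    map (rank σ) σ
      ≡⟨ trans (map-++ (rank σ) us _) (cong (map (rank σ) us ++_) (map-++ (rank σ) I (n ∷ J))) ⟩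
    map (rank σ) us ++ map (rank σ) I ++ rank σ n ∷ map (rank σ) J
      -- All of `1, …, d` occur, so they keep their values; the increasing word `us` takes the ranks
      -- from `d + 1` on; and `n` lies above all `m + d` other letters.
      ≡⟨ cong₂ _++_ rank-us (cong₂ _++_ (map-id-local (All.tabulate (rank-low ∘ I⊆)))
           (cong₂ _∷_ rank-n (map-id-local (All.tabulate (rank-low ∘ J⊆))))) ⟩
    interval (suc d) m ++ I ++ k ∷ J ∎
    where
    I J σ : List ℕ
    I = interval 1 j
    J = interval (suc j) (d ∸ j)
    σ = us ++ I ++ n ∷ J
    I++J : I ++ J ≡ interval 1 d
    I++J = trans (sym (interval-++ 1 j (d ∸ j))) (cong (interval 1) (m+[n∸m]≡n j≤d))
    I⊆ : v ∈ I → v ∈ interval 1 d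
    I⊆ v∈ = subst (_ ∈_) I++J (∈-++⁺ˡ v∈)
    J⊆ : v ∈ J → v ∈ interval 1 d
    J⊆ v∈ = subst (_ ∈_) I++J (∈-++⁺ʳ I v∈)
    count-s : v ≤ n → countLess σ v ≡ countLess us v + countLess (interval 1 d) v
    count-s {v} v≤n = begin
      countLess σ v ≡⟨ countLess-++ us (I ++ n ∷ J) v ⟩
      countLess us v + countLess (I ++ n ∷ J) v ≡⟨ cong (_+_ (countLess us v)) (countLess-++ I (n ∷ J) v) ⟩
      countLess us v + (countLess I v + countLess (n ∷ J) v)
        ≡⟨ cong (λ c → countLess us v + (countLess I v + c)) (countLess-≮ J v≤n) ⟩
      countLess us v + (countLess I v + countLess J v) ≡⟨ cong (_+_ (countLess us v)) (sym (countLess-++ I J v)) ⟩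
      countLess us v + countLess (I ++ J) v ≡⟨ cong (λ γ → countLess us v + countLess γ v) I++J ⟩
      countLess us v + countLess (interval 1 d) v ∎
    count-high : d < v → countLess (interval 1 d) v ≡ d
    count-high d<v = trans (countLess-all (All.tabulate λ z∈ → <-≤-trans (proj₂ (∈-interval⁻ {1} {d} z∈)) d<v))
      (length-interval 1 d)
    rank-low : v ∈ interval 1 d → rank σ v ≡ v
    rank-low {v} v∈ with 1≤v , s≤s v≤d ← ∈-interval⁻ {1} {d} v∈ = trans
      (cong suc (trans (count-s (≤-trans v≤d (<⇒≤ d<n)))
        (cong (_+ countLess (interval 1 d) v) (countLess-none (All.map (λ d<u → ≤-trans v≤d (<⇒≤ d<u)) big)))))
      (countLess-interval 1≤v (m≤n⇒m≤1+n v≤d))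
    rank-us : map (rank σ) us ≡ interval (suc d) m
    rank-us = begin
      map (rank σ) us
        ≡⟨ map-cong-local (All.tabulate λ {a} a∈ → cong suc (trans (count-s (<⇒≤ (All.lookup small a∈)))
             (trans (cong (_+_ (countLess us a)) (count-high (All.lookup big a∈))) (+-comm (countLess us a) d)))) ⟩
      map (λ a → suc d + countLess us a) us ≡⟨ countLess-increasing up (suc d) ⟩
      interval (suc d) (length us)          ≡⟨ cong (interval (suc d)) l ⟩
      interval (suc d) m                    ∎
    rank-n : rank σ n ≡ k
    rank-n = cong suc (trans (count-s ≤-refl) (cong₂ _+_ (trans (countLess-all small) l) (count-high d<n)))

  -- The occurrence consists of `us`, the letters up to `d` in front of `n`, then `n`, then the
  -- letters up to `d` behind it. These small letters spell `1, …, d`, and `j` is how many of them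
  -- precede `n`.
  max-in-prefix : ∀ us as {bs} → length us ≡ m → IsPerm n (us ++ as ++ n ∷ bs) → AllPairs _<_ us → All (d <_) us →
    AllPairs (Ord d) (as ++ n ∷ bs) → d < n → ¬ Avoids (us ++ as ++ n ∷ bs)
  max-in-prefix {n} us as {bs} l P up big ord d<n av = avoids-pat av j≤d
    ( us ++ as′ ++ n ∷ bs′
    , Sublist.++⁺ (⊆-refl {x = us}) (Sublist.++⁺ (Sublist.filter-⊆ (_≤? d) as) (refl {x = n} ∷ Sublist.filter-⊆ (_≤? d) bs))
    , trans (cong₂ (λ γ δ → std (us ++ γ ++ n ∷ δ)) as′≡ bs′≡) (std-pattern us l up big small d<n j≤d))
    where
    as′ = filter (_≤? d) as
    bs′ = filter (_≤? d) bs
    rest = as ++ n ∷ bs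
    small : All (_< n) us
    small = All.tabulate λ u∈ → ≤∧≢⇒< (≤n P (∈-++⁺ˡ u∈))
      λ { refl → Unique-++⁻ (unique P) u∈ (∈-++⁺ʳ as (here refl)) }
    split≡ : filter (_≤? d) rest ≡ as′ ++ bs′
    split≡ = trans (filter-++ (_≤? d) as (n ∷ bs)) (cong (as′ ++_) (filter-reject (_≤? d) (<⇒≱ d<n)))
    to : ∀ {z} → z ∈ filter (_≤? d) rest → z ∈ interval 1 d
    to z∈ with z∈vs , z≤d ← ∈-filter⁻ (_≤? d) {xs = rest} z∈ = ∈-interval⁺ (1≤ P (∈-++⁺ʳ us z∈vs)) (s≤s z≤d)
    from : ∀ {z} → z ∈ interval 1 d → z ∈ filter (_≤? d) rest
    from z∈ with 1≤z , s≤s z≤d ← ∈-interval⁻ {1} {d} z∈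
            with ∈-++⁻ us (IsPerm-full P 1≤z (≤-trans z≤d (<⇒≤ d<n)))
    ... | inj₁ z∈us = contradiction (All.lookup big z∈us) (≤⇒≯ z≤d)
    ... | inj₂ z∈vs = ∈-filter⁺ (_≤? d) z∈vs z≤d
    low : v ∈ filter (_≤? d) rest → v ≤ d
    low v∈ = proj₂ (∈-filter⁻ (_≤? d) {xs = rest} v∈)
    filtered : as′ ++ bs′ ≡ interval 1 d
    filtered = trans (sym split≡) (increasing-≡
      (pairs⁺ λ s → pairs⁻ ord (⊆-trans s (Sublist.filter-⊆ (_≤? d) rest)) (low (⊆-∈ s (here refl))) (low (⊆-∈ s (there (here refl)))))
      (interval-increasing 1 d) to from)
    j = length as′
    decomposed = interval-++⁻ 1 d as′ (sym filtered)
    j≤d = proj₁ decomposed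
    as′≡ = proj₁ (proj₂ decomposed)
    bs′≡ = proj₂ (proj₂ decomposed)

  1∈patTail : ∀ j → 1 ∈ patTail j
  1∈patTail zero = there (∈-interval⁺ {1} {d} ≤-refl (s≤s (s≤s z≤n)))
  1∈patTail (suc j) = ∈-++⁺ˡ (∈-interval⁺ {1} {suc j} ≤-refl (s≤s (s≤s z≤n)))

  -- In a long pattern, each of the first m letters exceeds the 1 behind it, so the first m
  -- letters of an occurrence exhaust us; but then the letter playing k exceeds the maximum n.
  twoRuns-avoids : ∀ us → length us ≡ m → IsPerm n (us ++ vs) → AllPairs _<_ us → AllPairs _<_ vs → n ∈ us →
    Avoids (us ++ vs)
  twoRuns-avoids {n} {vs} us l P up upv n∈ = avoids⁺ no321 nopat
    where
    no321 : ∀ {a b c} → a ∷ b ∷ c ∷ [] ⊆ us ++ vs → b < a → ¬ c < b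
    -- The middle letter ends one descent and begins another, so it would lie in both runs.
    no321 {a} s b<a c<b = Unique-++⁻ (unique P)
      (proj₁ (descent us up upv (⊆-trans (a ∷ʳ ⊆-refl) s) c<b))
      (proj₂ (descent us up upv (⊆-trans (refl ∷ refl ∷ minimum _) s) b<a))
    nopat : ∀ {j} → j ≤ d → ¬ Contains (us ++ vs) (interval (suc d) m ++ patTail j)
    nopat {j} j≤d (s , s⊆ , eq)
      with s₁ , s₂ , refl , eq₁ , eq₂ ← map≡++⁻ (rank s) s eq
      with x , x∈ , k≡ ← ∈-map⁻ (rank s) (subst (k ∈_) (sym eq₂) (∈-++⁺ʳ (interval 1 j) (here refl)))
      with y , y∈ , 1≡ ← ∈-map⁻ (rank s) (subst (1 ∈_) (sym eq₂) (1∈patTail j))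
      = <⇒≱ n<x (≤n P (⊆-∈ s⊆ (∈-++⁺ʳ s₁ x∈)))
      where
      rank∈ : ∀ {a} → a ∈ s₁ → rank s a ∈ interval (suc d) m
      rank∈ {a} a∈ = subst (rank s a ∈_) eq₁ (∈-map⁺ (rank s) a∈)
      s₁⊆us : ∀ {a} → a ∈ s₁ → a ∈ us
      s₁⊆us {a} a∈ = proj₁ (descent us up upv (⊆-trans (Sublist.++⁺ (from∈ a∈) (from∈ y∈)) s⊆)
        (countLess-reflects s (s≤s⁻¹ (subst (_< rank s a) 1≡
          (≤-trans (s≤s (s≤s z≤n)) (proj₁ (∈-interval⁻ {suc d} {m} (rank∈ a∈))))))))
      s₁-length : length us ≤ length s₁
      s₁-length = ≤-reflexive (trans l (trans (sym (length-interval (suc d) m))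
        (trans (cong length (sym eq₁)) (length-map (rank s) s₁))))
      n∈s₁ : n ∈ s₁
      n∈s₁ = unique⊆-full (⊆-unique (⊆-trans (Sublist.++⁺ʳ s₂ ⊆-refl) s⊆) (unique P)) s₁⊆us s₁-length n∈
      n<x : n < x
      n<x = countLess-reflects s (s≤s⁻¹ (subst (rank s n <_) (trans (cong suc (+-comm d m)) k≡)
        (proj₂ (∈-interval⁻ {suc d} {m} (rank∈ n∈s₁)))))

  H-top : ∀ n → H m d n ≡ twoRunsCount m d n
  H-top n = count-cong {xs = perms n} (class? m d) (split? m (twoRuns? n d)) to from
    where
    to : α ∈ perms n → Class m d α → Split m (TwoRuns n d) α
    to α∈ (([] , _ , _ , () , _) , _)
    to α∈ ((us@(u ∷ _) , vs , refl , l , up , big , ord) , _ , av) =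
      us , vs , refl , l , up , big , pairs⁺ ascending , n∈us
      where
      P = ∈perms⇒IsPerm n α∈
      d<n : d < n
      d<n = <-≤-trans (All.head big) (≤n P (here refl))
      n∈us : n ∈ us
      n∈us with ∈-++⁻ us (IsPerm-full P (≤-trans (s≤s z≤n) d<n) ≤-refl)
      ... | inj₁ n∈ = n∈
      ... | inj₂ n∈vs with as , bs , refl ← ∈-∃++ n∈vs =
        ⊥-elim (max-in-prefix us as l P up big ord d<n (avoids av))
      ascending : x ∷ y ∷ [] ⊆ vs → x < y
      ascending {x} {y} s with <-cmp x y
      ... | tri< x<y _ _ = x<y
      ... | tri≈ _ refl _ = contradiction refl (pairs⁻ (unique P) (Sublist.++⁺ (minimum us) s))
      -- The maximum stands in `us`, before `x` and `y`, so a descent in `vs` completes a 321.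
      ... | tri> _ _ y<x = contradiction y<x
        (avoids-321 (avoids av) (Sublist.++⁺ (from∈ n∈us) s) (≤∧≢⇒< (≤n P (∈-++⁺ʳ us x∈vs))
          λ { refl → Unique-++⁻ (unique P) n∈us x∈vs }))
        where
        x∈vs = ⊆-∈ s (here refl)

    from : α ∈ perms n → Split m (TwoRuns n d) α → Class m d α
    from α∈ (us , vs , refl , l , up , big , upv , n∈) =
      (us , vs , refl , l , up , big , AllPairs.map (λ x<y _ _ → x<y) upv)
      , subst (d ≤_) (sym (len P)) (<⇒≤ (All.lookup big n∈))
      , ⇒avoidsAll X _ (twoRuns-avoids us l P up upv n∈)
      where
      P = ∈perms⇒IsPerm n α∈

  H-top-value : ∀ i → H m d (suc (d + i)) ≡ i C m′
  H-top-value i = trans (H-top (suc (d + i))) (twoRuns-count m′ d i)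

  H-top-zero : n ≤ d → H m d n ≡ 0
  H-top-zero {n} n≤d = trans (H-top n) (twoRuns-none {p = m} n≤d)

  -- From the counts to their power series

  H-start : ∀ n → H 0 0 n ≡ x¹ k d n
  H-start n = trans
    (count-cong {xs = perms n} (class? 0 0) (Bool.T? ∘ avoidsAll X) (λ _ → proj₂ ∘ proj₂)
      (λ {α} α∈ av → ([] , α , refl , refl , [] , [] , pairs⁺ λ s x≤0 →
          contradiction (1≤ (∈perms⇒IsPerm n α∈) (⊆-∈ s (here refl))) (≤⇒≯ x≤0))
        , z≤n , av))
    (sym (countB≡count (avoidsAll X) (perms n)))

  -- For positive size, `H-q-step` and `H-p-step` have the same right-hand side. At size 0 both
  -- counts vanish: one needs a letter in the prefix, the other `suc q ≤ 0`.
  H-exchange : suc p ≤ m → suc q ≤ d → ∀ n → H (suc p) q n ≡ H p (suc q) n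
  H-exchange {p} {q} _ _ zero = trans
    (count-none {xs = perms 0} (class? (suc p) q) λ { (here refl) ((_ ∷ _ , _ , () , _) , _) })
    (sym (count-none {xs = perms 0} (class? p (suc q)) λ { (here refl) (_ , () , _) }))
  H-exchange {p} {q} p<m q<d (suc n) = trans (H-q-step {q} {p} {n} q<d) (sym (H-p-step {p} {q} {n} p<m))

  -- A prefix of one letter is no restriction on a nonempty permutation. The two counts differ at
  -- size 0, whence the `oneS` in `h 1`.
  H-first : ∀ n → H 1 0 (suc n) ≡ H 0 0 (suc n)
  H-first n = count-cong {xs = perms (suc n)} (class? 1 0) (class? 0 0)
    (λ { _ ((us , vs , refl , l , shape) , 0≤ , av) →
       ([] , us ++ vs , refl , refl , [] , [] , shape-ord us shape) , 0≤ , av })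
    λ { {[]} α∈ _ → case len (∈perms⇒IsPerm (suc n) α∈) of λ ()
      ; {a ∷ α} α∈ (([] , _ , refl , refl , [] , [] , _ ∷ ord) , 0≤ , av) →
        (a ∷ [] , α , refl , refl , [] ∷ [] , 1≤ (∈perms⇒IsPerm (suc n) α∈) (here refl) ∷ [] , ord) , 0≤ , av }

  K : ℕ
  K = m + d

  -- The series of H p q, as a function of p + q only.
  h : ℕ → Series
  h zero = genX k d
  h (suc zero) n = genX k d n ℤ.- oneS n
  h (suc (suc r)) n = h (suc r) n ℤ.- shiftX (h r) n

  h-rec : ∀ r n → h (suc r) (suc n) ≡ h (suc (suc r)) (suc n) ℤ.+ h r n
  h-rec r n = sym (cancel (h (suc r) (suc n)) (h r n))
    where
    cancel : ∀ x y → x ℤ.- y ℤ.+ y ≡ x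
    cancel = ℤSolver.solve-∀

  H-start-zero : H 0 0 0 ≡ 1
  H-start-zero = count-cong {xs = perms 0} (class? 0 0) (λ _ → yes tt) _ λ { (here refl) _ →
    ([] , [] , refl , refl , [] , [] , []) , z≤n , ⇒avoidsAll X [] (avoids⁺ {α = []} (λ ()) λ _ → λ { ([] , [] , ()) }) }

  h-zero : ∀ r → h (suc r) 0 ≡ 0ℤ
  h-zero zero = cong (λ c → + c ℤ.- 1ℤ) (trans (sym (H-start 0)) H-start-zero)
  h-zero (suc r) = trans (ℤ.+-identityʳ (h (suc r) 0)) (h-zero r)

  -- Induction on the level `r = p + q`. From level 2 on, `H-exchange` moves a pair on the boundary
  -- one place inside, and `H≡h-interior` treats positive `p` and `q` by `H-p-step`, from the two
  -- levels below.
  H≡h : ∀ r p q → p + q ≡ r → p ≤ m → q ≤ d → ∀ n → + H p q n ≡ h r n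
  H≡h-interior : ∀ r p q → suc p + q ≡ r → suc p ≤ m → suc q ≤ d → ∀ n → + H (suc p) (suc q) n ≡ h (suc r) n

  H≡h zero zero zero _ _ _ n = cong +_ (H-start n)
  H≡h (suc zero) (suc zero) zero _ _ _ zero = sym (h-zero 0)
  H≡h (suc zero) (suc zero) zero _ _ _ (suc n) =
    trans (cong +_ (trans (H-first n) (H-start (suc n)))) (sym (ℤ.+-identityʳ _))
  H≡h (suc zero) zero (suc zero) _ _ q≤ n =
    trans (cong +_ (sym (H-exchange {0} {0} (s≤s z≤n) q≤ n))) (H≡h 1 1 0 refl (s≤s z≤n) z≤n n)
  H≡h (suc (suc r)) zero (suc (suc q)) eq _ q≤ n =
    trans (cong +_ (sym (H-exchange {0} {suc q} (s≤s z≤n) q≤ n)))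
      (H≡h-interior (suc r) 0 q (suc-injective eq) (s≤s z≤n) (<⇒≤ q≤) n)
  H≡h (suc (suc r)) (suc (suc p)) zero eq p≤ _ n =
    trans (cong +_ (H-exchange {suc p} {0} p≤ (s≤s z≤n) n))
      (H≡h-interior (suc r) p 0 (suc-injective eq) (<⇒≤ p≤) (s≤s z≤n) n)
  H≡h (suc (suc r)) (suc p) (suc q) eq p≤ q≤ n =
    H≡h-interior (suc r) p q (trans (sym (+-suc p q)) (suc-injective eq)) p≤ q≤ n

  H≡h-interior (suc r) p q eq p≤ q≤ zero = trans
    (cong +_ (count-none {xs = perms 0} (class? (suc p) (suc q)) λ { (here refl) (_ , () , _) }))
    (sym (h-zero (suc r)))
  H≡h-interior (suc r) p q eq p≤ q≤ (suc n) = begin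
    + H (suc p) (suc q) (suc n)
      ≡⟨ cancel (+ H (suc p) (suc q) (suc n)) (+ H p q n) ⟩
    + (H (suc p) (suc q) (suc n) + H p q n) ℤ.- + H p q n
      ≡⟨ cong (λ c → + c ℤ.- + H p q n) (sym (H-p-step {p} {q} {n} p≤)) ⟩
    + H p (suc q) (suc n) ℤ.- + H p q n
      ≡⟨ cong₂ ℤ._-_ (H≡h (suc r) p (suc q) (trans (+-suc p q) eq) (<⇒≤ p≤) q≤ (suc n))
                     (H≡h r p q (suc-injective eq) (<⇒≤ p≤) (<⇒≤ q≤) n) ⟩
    h (suc (suc r)) (suc n) ∎
    where
    cancel : ∀ x y → x ≡ x ℤ.+ y ℤ.- y
    cancel = ℤSolver.solve-∀

  h-top : ∀ n → h K n ≡ + H m d n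
  h-top n = sym (H≡h K m d refl ≤-refl ≤-refl n)

  h-top-value : ∀ i → h K (suc (d + i)) ≡ + (i C m′)
  h-top-value i = trans (h-top _) (cong +_ (H-top-value i))

  -- In closed form `x^(k-1) / (1 - x)^m`: the shift gives `x^(d+1)` and `binomials m′` gives
  -- `x^(m-1) / (1 - x)^m`.
  h-top-series : ∀ n → h K n ≡ shiftBy (suc d) (binomials m′) n
  h-top-series n with n ≤? d
  ... | yes n≤d = trans (h-top n) (trans (cong +_ (H-top-zero n≤d)) (sym (shiftBy-< (suc d) _ n (s≤s n≤d))))
  ... | no n≰d = subst (λ n → h K n ≡ shiftBy (suc d) (binomials m′) n) (m+[n∸m]≡n (≰⇒> n≰d))
    (trans (h-top-value (n ∸ suc d)) (sym (shiftBy-≥ (suc d) (binomials m′) (n ∸ suc d))))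

  -- Both sides obey the Chebyshev recurrence in `r`. At `r = 1` the summand `Ŭ 0` gives back the 1
  -- subtracted in `h 1`.
  Ŭ-⊛-genX : ∀ r n → (Ŭ r ⊛ genX k d) n ≡ h r n ℤ.+ Ŭ⁻ r n
  Ŭ-⊛-genX zero n = trans (⊛-oneˡ (genX k d) n) (sym (ℤ.+-identityʳ _))
  Ŭ-⊛-genX (suc zero) n = trans (⊛-oneˡ (genX k d) n) (cancel (genX k d n) (oneS n))
    where
    cancel : ∀ x y → x ≡ x ℤ.- y ℤ.+ y
    cancel = ℤSolver.solve-∀
  Ŭ-⊛-genX (suc (suc r)) n = begin
    (Ŭ (suc (suc r)) ⊛ genX k d) n
      ≡⟨ ⊛-subˡ (Ŭ (suc r)) (shiftX (Ŭ r)) (genX k d) n ⟩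
    (Ŭ (suc r) ⊛ genX k d) n ℤ.- (shiftX (Ŭ r) ⊛ genX k d) n
      ≡⟨ cong₂ ℤ._-_ (Ŭ-⊛-genX (suc r) n)
           (trans (⊛-shiftˡ (Ŭ r) (genX k d) n) (shiftX-cong (Ŭ-⊛-genX r) n)) ⟩
    h (suc r) n ℤ.+ Ŭ r n ℤ.- shiftX (h r ⊕ Ŭ⁻ r) n
      ≡⟨ cong (λ t → h (suc r) n ℤ.+ Ŭ r n ℤ.- t) (shiftX-⊕ n) ⟩
    h (suc r) n ℤ.+ Ŭ r n ℤ.- (shiftX (h r) n ℤ.+ shiftX (Ŭ⁻ r) n)
      ≡⟨ regroup (h (suc r) n) (Ŭ r n) (shiftX (h r) n) (shiftX (Ŭ⁻ r) n) ⟩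
    h (suc (suc r)) n ℤ.+ (Ŭ r n ℤ.- shiftX (Ŭ⁻ r) n)
      ≡⟨ cong (λ t → h (suc (suc r)) n ℤ.+ t) (sym (Ŭ-suc r n)) ⟩
    h (suc (suc r)) n ℤ.+ Ŭ (suc r) n ∎
    where
    shiftX-⊕ : ∀ n → shiftX (h r ⊕ Ŭ⁻ r) n ≡ shiftX (h r) n ℤ.+ shiftX (Ŭ⁻ r) n
    shiftX-⊕ zero = refl
    shiftX-⊕ (suc n) = refl
    regroup : ∀ a b c e → a ℤ.+ b ℤ.- (c ℤ.+ e) ≡ a ℤ.- c ℤ.+ (b ℤ.- e)
    regroup = ℤSolver.solve-∀

  -- The linear recurrence and the generating function

  recurrence : ∀ n → k ≤ n → recLHS k d n ≡ + ((n ∸ d ∸ 1) C (k ∸ d ∸ 2))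
  recurrence n k≤n = begin
    recLHS k d n
      ≡⟨ cong sumℤ (map-cong (λ j → cong (ℤ._* + x¹ k d (n ∸ j)) (sym (Ŭ-coefficient K j))) (upTo k)) ⟩
    sumℤ (map term (upTo k))
      -- The given sum stops at `j = k - 1` and the product runs to `j = n`; the added terms lie
      -- beyond the degree of `Ŭ K`.
      ≡⟨ sym (sum-upTo-truncate term k (suc n ∸ k) λ j k≤j → cong (ℤ._* + x¹ k d (n ∸ j)) (Ŭ-vanishes K j k≤j)) ⟩
    sumℤ (map term (upTo (k + (suc n ∸ k))))
      ≡⟨ cong (λ N → sumℤ (map term (upTo N))) (m+[n∸m]≡n (m≤n⇒m≤1+n k≤n)) ⟩
    (Ŭ K ⊛ genX k d) n
      ≡⟨ Ŭ-⊛-genX K n ⟩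
    h K n ℤ.+ Ŭ (m′ + d) n
      -- Since `k ≤ n`, the index `n` lies beyond the degree of `Ŭ (K - 1)`, and only the top series
      -- remains.
      ≡⟨ cong₂ ℤ._+_ (cong (h K) (sym n≡)) (Ŭ-vanishes (m′ + d) n (<⇒≤ k≤n)) ⟩
    h K (suc (d + i)) ℤ.+ 0ℤ
      ≡⟨ trans (ℤ.+-identityʳ _) (h-top-value i) ⟩
    + (i C m′)
      ≡⟨ cong₂ (λ a b → + (a C b)) i≡ (sym (cong (_∸ 2) (m+n∸n≡m (suc m) d))) ⟩
    + ((n ∸ d ∸ 1) C (k ∸ d ∸ 2)) ∎
    where
    term : ℕ → ℤ
    term j = Ŭ K j ℤ.* + x¹ k d (n ∸ j)
    i = n ∸ suc d
    n≡ : suc (d + i) ≡ n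
    n≡ = m+[n∸m]≡n (≤-trans (s≤s (m≤n+m d m)) k≤n)
    i≡ : i ≡ n ∸ d ∸ 1
    i≡ = sym (trans (∸-+-assoc n d 1) (cong (n ∸_) (+-comm d 1)))

  -- Multiplying numerator and denominator of the closed form by `x^((k-2)/2)` turns the Chebyshev
  -- terms into `Ŭ (k - 2)` and `Ŭ (k - 1)` and `x^(k/2)` into `x^(k-1)`. Clearing denominators
  -- leaves this identity.
  series : ∀ n → (genX k d ⊛ (Ŭ (k ∸ 1) ⊛ powS oneMinusX (k ∸ d ∸ 1))) n
    ≡ ((Ŭ (k ∸ 2) ⊛ powS oneMinusX (k ∸ d ∸ 1)) ⊕ xPow (k ∸ 1)) n
  series n rewrite cong (_∸ 1) (m+n∸n≡m (suc m) d) = begin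
    (genX k d ⊛ (Ŭ K ⊛ P)) n                   ≡⟨ sym (⊛-assoc (genX k d) (Ŭ K) P n) ⟩
    ((genX k d ⊛ Ŭ K) ⊛ P) n                   ≡⟨ ⊛-congˡ P (λ i → trans (⊛-comm (genX k d) (Ŭ K) i) (Ŭ-⊛-genX K i)) n ⟩
    ((h K ⊕ Ŭ (m′ + d)) ⊛ P) n                 ≡⟨ ⊛-addˡ (h K) (Ŭ (m′ + d)) P n ⟩
    (h K ⊛ P) n ℤ.+ (Ŭ (m′ + d) ⊛ P) n         ≡⟨ ℤ.+-comm ((h K ⊛ P) n) _ ⟩
    (Ŭ (m′ + d) ⊛ P) n ℤ.+ (h K ⊛ P) n         ≡⟨ cong (λ t → (Ŭ (m′ + d) ⊛ P) n ℤ.+ t) remainder ⟩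
    (Ŭ (m′ + d) ⊛ P) n ℤ.+ xPow K n            ∎
    where
    P : Series
    P = powS oneMinusX m
    remainder : (h K ⊛ P) n ≡ xPow K n
    remainder = begin
      (h K ⊛ P) n                              ≡⟨ ⊛-congˡ P h-top-series n ⟩
      (shiftBy (suc d) (binomials m′) ⊛ P) n   ≡⟨ shiftBy-⊛ (suc d) (binomials m′) P n ⟩
      shiftBy (suc d) (binomials m′ ⊛ P) n     ≡⟨ shiftBy-cong (suc d) (binomials-⊛ m′) n ⟩
      shiftBy (suc d) (shiftBy m′ oneS) n      ≡⟨ shiftBy-+ (suc d) m′ oneS n ⟩
      shiftBy (suc d + m′) oneS n              ≡⟨ cong (λ j → shiftBy (suc j) oneS n) (+-comm d m′) ⟩
      shiftBy K oneS n                         ≡⟨ sym (xPow≡shiftBy K n) ⟩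
      xPow K n                                 ∎

  -- Sizes below k: ballot and Catalan numbers

  h-vanishes : ∀ n t r → r + t ≡ K → n < r → h r n ≡ 0ℤ
  h-vanishes n zero r eq n<r with refl ← trans (sym (+-identityʳ r)) eq with n ≤? d
  ... | yes n≤d = trans (h-top n) (cong +_ (H-top-zero n≤d))
  ... | no n≰d = subst (λ n → h K n ≡ 0ℤ) (m+[n∸m]≡n (≰⇒> n≰d))
    (trans (h-top-value (n ∸ suc d)) (cong +_ (k>n⇒nCk≡0 (+-cancelˡ-< (suc d) _ _
      (subst₂ _<_ (sym (m+[n∸m]≡n (≰⇒> n≰d))) (cong suc (+-comm m′ d)) n<r)))))
  h-vanishes zero (suc t) (suc r) eq _ = h-zero r
  -- Here `t` is the distance to the top level `K`. `h-rec` leads either one level up at the same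
  -- size or one level down at a smaller size, so the recursion is lexicographic in size and `t`.
  h-vanishes (suc n) (suc t) (suc r) eq (s≤s n<r) = trans (h-rec r n) (cong₂ ℤ._+_
    (h-vanishes (suc n) t (suc (suc r)) (trans (cong suc (sym (+-suc r t))) eq) (s≤s (m≤n⇒m≤1+n n<r)))
    (h-vanishes n (suc (suc t)) r (trans (+-suc r (suc t)) eq) n<r))

  -- In `h-rec` the term from the level above lies under its diagonal and vanishes, so the value 1
  -- at level 0 is passed on. At level `K` it is read off the binomial.
  h-diagonal : ∀ r → r ≤ K → h r r ≡ 1ℤ
  h-diagonal zero _ = cong +_ (trans (sym (H-start 0)) H-start-zero)
  h-diagonal (suc r) r<K with m≤n⇒m<n∨m≡n r<K
  ... | inj₁ r+2≤K = trans (h-rec r r) (cong₂ ℤ._+_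
    (h-vanishes (suc r) (K ∸ suc (suc r)) (suc (suc r)) (m+[n∸m]≡n r+2≤K) ≤-refl) (h-diagonal r (<⇒≤ r<K)))
  ... | inj₂ refl = trans (cong (h K ∘ suc) (+-comm m′ d)) (trans (h-top-value m′) (cong +_ (nCn≡1 m′)))

  h-ballot : ∀ r s → r + s ≤ K → h r (r + s) ≡ + ballot r s
  h-ballot r zero le = trans (cong (h r) (+-identityʳ r)) (h-diagonal r (subst (_≤ K) (+-identityʳ r) le))
  h-ballot zero (suc s) le = trans (sym (ℤ.+-identityʳ (h 0 (suc s)))) (h-ballot 1 s le)
  h-ballot (suc r) (suc s) le = trans (h-rec r (r + suc s)) (cong₂ ℤ._+_
    (trans (cong (h (suc (suc r)) ∘ suc) (+-suc r s))
      (h-ballot (suc (suc r)) s (subst (_≤ K) (cong suc (+-suc r s)) le)))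
    (h-ballot r (suc s) (<⇒≤ le)))

  catalan : ∀ n → n ≤ k ∸ 1 → x¹ k d n ≡ ((2 * n) C n) / suc n
  catalan n n≤K = trans (ℤ.+-injective (h-ballot 0 n n≤K)) (ballot-catalan n)

theorem3p1 : (k d : ℕ) → 3 ≤ k → 1 ≤ d → d ≤ k ∸ 2 →
    ((n : ℕ) → k ≤ n → recLHS k d n ≡ + ((n ∸ d ∸ 1) C (k ∸ d ∸ 2)))
    × ((n : ℕ) → n ≤ k ∸ 1 → x¹ k d n ≡ ((2 * n) C n) / suc n)
    × ((n : ℕ) → (genX k d ⊛ (Ŭ (k ∸ 1) ⊛ powS oneMinusX (k ∸ d ∸ 1))) n
    ≡ ((Ŭ (k ∸ 2) ⊛ powS oneMinusX (k ∸ d ∸ 1)) ⊕ xPow (k ∸ 1)) n)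
theorem3p1 (suc zero) _ (s≤s ())
-- With `m′ = k - 2 - d` for the original `k`, matching `m′ + d` against `k - 2` makes that `k` the
-- one of `Avoidance` by definition.
theorem3p1 (suc (suc k)) (suc d′) _ _ d≤k with k ∸ suc d′ | m∸n+n≡m d≤k
... | m′ | refl = recurrence , catalan , series
  where open Avoidance m′ d′
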